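{- Let $n,K,M,s,f$ be integers with $n=KM$, $K \ge 1$, $1\le s\le M$ and $0\le f\le n-2$, and consider the parallel mixnet process on $n$ cards with $M$ servers, each handling $K$ cards per round, with $M-s$ corrupted servers and $f$ adversarially generated (marked) inputs, and with potential $\Phi(t)$ after $t$ rounds. Let $\gamma=\mathbf{E}[\Delta\Phi/\Phi]$ be the expected relative decrease of the potential in one round in that setting. Let $b\ge 1$ be fixed. If $0<\gamma<1$, then after $t=\lceil b\log_{1/(1-\gamma)} n\rceil$ rounds the expected sum-of-squares error between the card-assignment probabilities and the uniform distribution satisfies $\mathbf{E}[\Phi(t)]\le 1/n^b$. In particular: if $\gamma\ge 1/2$, then $\mathbf{E}[\Phi(t)]\le 1/n^b$ already holds for $t=\lceil b\log_2 n\rceil$ rounds; and if $\gamma\ge 1-n^{ -1/c}$ for a constant $c\ge 1$, then $\mathbf{E}[\Phi(t)]\le 1/n^b$ already holds for $t=\lceil bc\rceil$ rounds.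
   Context: Parallel mixnet with corrupted servers and adversarially generated inputs: there are $n$ cards (messages) and $M=n/K$ servers, of which a fixed set of $s$ servers is non-corrupted and the other $M-s$ are corrupted; $f$ of the $n$ cards are marked (fake messages injected by the adversary). In each round, (1) the cards are placed in order according to a uniformly random permutation, independent of all previous randomness, which the adversary sees; (2) under this ordering the cards are divided into $M$ consecutive groups of $K$ cards, one group per server; (3) each server permutes its $K$ cards uniformly at random; the permutation is hidden from the adversary if the server is non-corrupted and revealed to the adversary if it is corrupted (so it may be treated as the identity). The adversary knows the initial ordering and always sees the locations of the marked cards. A particular unmarked card is tracked. For $i=1,\dots,n-f$, $w_i(t)$ is the probability, from the point of view of the adversary, that the $i$-th unmarked card after $t$ rounds is the tracked card. Concretely, $w(0)=(1,0,\dots,0)\in\mathbb{R}^{n-f}$, and in each round: the $n$ cards (the $n-f$ unmarked ones carrying the weights $w_1(t),\dots,w_{n-f}(t)$ and the $f$ marked ones carrying no weight) are assigned to the $n$ positions by a fresh uniformly random permutation; the positions are split into $M$ consecutive blocks of size $K$, one per server; in each block belonging to a non-corrupted server, the weights of the $K'\le K$ unmarked cards in that block are all replaced by their average; weights in blocks of corrupted servers are unchanged. The resulting weights are $w(t+1)$. The potential (sum-of-squares error relative to the uniform distribution on the $n-f$ unmarked cards) is $$\Phi(t)=\left(\sum_{i=1}^{n-f} w_i(t)^2\right)-\frac{1}{n-f}=\sum_{i=1}^{n-f}\left(w_i(t)-\frac1{n-f}\right)^2,$$ a random variable depending on the visible randomness, and $\mathbf{E}$ denotes expectation over that randomness. The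 cases $s=M$ (no corrupted servers) or $f=0$ (no marked inputs) are allowed. One writes $\Delta\Phi(t)=\Phi(t)-\Phi(t+1)$. The quantity $\gamma=\mathbf{E}[\Delta\Phi/\Phi]$ means the expectation of $\Delta\Phi(t)/\Phi(t)$ over the randomness of a single round, given the current weight vector $w(t)$ with $\Phi(t)>0$; in this setting its value does not depend on $t$ or on $w(t)$, only on $n,K,s,f$. -}

module Defs where

open import Data.Nat.Base as ℕ using (ℕ; zero; suc)
open import Data.Nat.Properties using (m∸n≤m)
open import Data.Integer.Base using (+_; -[1+_])
open import Data.Rational.Base
open import Data.Rational.Properties
  using (pos⇒nonZero; +-monoˡ-<; +-inverseʳ; +-*-rawSemiring)
open import Algebra.Definitions.RawSemiring +-*-rawSemiring using (_^_; sum)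
open import Data.Bool.Base using (if_then_else_)
open import Data.Fin.Base using (Fin; zero; suc; inject≤; quotient)
open import Data.Fin.Properties using (_≟_)
open import Data.Fin.Permutation using (Permutation′; _⟨$⟩ʳ_; insert)
import Data.Fin.Permutation as Perm
open import Data.Fin.Subset using (Subset)
open import Data.Fin.Subset.Properties using (_∈?_)
open import Data.List.Base
  using (List; []; _∷_; map; foldr; filter; length; allFin; cartesianProductWith)
open import Data.Vec.Base as Vec using (Vec; []; _∷_)
open import Data.Product.Base using (_×_; ∃-syntax)
open import Data.Sum.Base using (_⊎_)
open import Function.Base using (_∘_)
open import Function.Bundles using (_⇔_)
open import Relation.Binary.PropositionalEquality using (_≡_; subst)
open import Relation.Nullary.Decidable using (does)
open import Relation.Nullary.Negation using (¬_)

fromℕ : ℕ → ℚ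
fromℕ n = + n / 1

-- The reciprocal of a natural number.  The value at 0 is a convention and is
-- only reached by the mean of an empty list.
recip : ℕ → ℚ
recip zero    = 0ℚ
recip (suc n) = + 1 / suc n

mean : List ℚ → ℚ
mean xs = foldr _+_ 0ℚ xs * recip (length xs)

-- Dedekind reals.  Operations are defined on bare pairs of sets of rationals;
-- a real number is such a pair satisfying IsReal.

record Cut : Set₁ where
  field
    L : ℚ → Set
    U : ℚ → Set

open Cut public

record IsReal (x : Cut) : Set where
  field
    L-inhabited : ∃[ q ] L x q
    U-inhabited : ∃[ q ] U x q
    L-rounded   : ∀ q → L x q ⇔ (∃[ r ] (q < r × L x r))
    U-rounded   : ∀ q → U x q ⇔ (∃[ r ] (r < q × U x r))
    separated   : ∀ {q r} → L x q → U x r → q < r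
    located     : ∀ {q r} → q < r → L x q ⊎ U x r

ι : ℚ → Cut
ι p .L q = q < p
ι p .U q = p < q

infix 4 _<ᴿ_ _≤ᴿ_
infixl 6 _-ᴿ_
infixl 7 _*ᴿ_
infix 8 -ᴿ_ 1/ᴿ_
infixr 8 _^ᴿ_

_<ᴿ_ : Cut → Cut → Set
x <ᴿ y = ∃[ q ] (U x q × L y q)

_≤ᴿ_ : Cut → Cut → Set
x ≤ᴿ y = ¬ (y <ᴿ x)

-ᴿ_ : Cut → Cut
(-ᴿ x) .L q = U x (- q)
(-ᴿ x) .U q = L x (- q)

_-ᴿ_ : Cut → Cut → Cut
(x -ᴿ y) .L q = ∃[ a ] ∃[ b ] (L x a × U y b × q < a - b)
(x -ᴿ y) .U q = ∃[ a ] ∃[ b ] (U x a × L y b × a - b < q)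

-- Interval multiplication: the product of [a , a′] and [b , b′] is spanned by
-- the four products of endpoints, so no sign restriction is needed.
_*ᴿ_ : Cut → Cut → Cut
(x *ᴿ y) .L q = ∃[ a ] ∃[ a′ ] ∃[ b ] ∃[ b′ ]
  ( L x a × U x a′ × L y b × U y b′
  × q < ((a * b) ⊓ (a * b′)) ⊓ ((a′ * b) ⊓ (a′ * b′)) )
(x *ᴿ y) .U q = ∃[ a ] ∃[ a′ ] ∃[ b ] ∃[ b′ ]
  ( L x a × U x a′ × L y b × U y b′
  × ((a * b) ⊔ (a * b′)) ⊔ ((a′ * b) ⊔ (a′ * b′)) < q )

-- Only meaningful for positive x.
1/ᴿ_ : Cut → Cut
(1/ᴿ x) .L q = ∃[ r ] (0ℚ < r × U x r × q * r < 1ℚ)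
(1/ᴿ x) .U q = ∃[ r ] (0ℚ < r × L x r × 1ℚ < q * r)

-- β ^ r < q and q < β ^ r for a positive rational β and a rational exponent
-- r = ± j / k, with roots and negative powers cleared: for positive q,
-- β ^ (j / k) < q iff β ^ j < q ^ k, and β ^ (- j / k) < q iff 1 < q ^ k * β ^ j.

Pow< : ℚ → ℚ → ℚ → Set
Pow< β (mkℚ (+ j)    k-1 _) q = 0ℚ < q × β ^ j < q ^ suc k-1
Pow< β (mkℚ -[1+ j ] k-1 _) q = 0ℚ < q × 1ℚ < q ^ suc k-1 * β ^ suc j

<Pow : ℚ → ℚ → ℚ → Set
<Pow q β (mkℚ (+ j)    k-1 _) = q ≤ 0ℚ ⊎ q ^ suc k-1 < β ^ j
<Pow q β (mkℚ -[1+ j ] k-1 _) = q ≤ 0ℚ ⊎ q ^ suc k-1 * β ^ suc j < 1ℚ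

-- Real powers of a rational base β ≥ 1: monotone in the exponent, hence
-- approximated by rational exponents below and above.
_^ᴿ_ : ℚ → Cut → Cut
(β ^ᴿ x) .L q = ∃[ r ] (L x r × <Pow q β r)
(β ^ᴿ x) .U q = ∃[ r ] (U x r × Pow< β r q)

-- The logarithm of a positive rational x to a rational base β > 1.
log : ℚ → ℚ → Cut
log β x .L r = Pow< β r x
log β x .U r = <Pow x β r

-- t = ⌈ x ⌉.  This is a relation because the ceiling of a Dedekind real is not
-- computable.
_≡⌈_⌉ : ℕ → Cut → Set
t ≡⌈ x ⌉ = (ι (fromℕ t - 1ℚ) <ᴿ x) × (x ≤ᴿ ι (fromℕ t))

1/[1-_] : (γ : ℚ) → γ < 1ℚ → ℚ
1/[1- γ ] γ<1 = 1/_ (1ℚ - γ) {{>-nonZero (subst (_< 1ℚ - γ) (+-inverseʳ γ) (+-monoˡ-< (- γ) γ<1))}}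

-- All n! permutations, each listed once: the image j of 0 is chosen freely and
-- the remaining points are matched by a permutation of n points.
permutations : ∀ n → List (Permutation′ n)
permutations zero    = Perm.id ∷ []
permutations (suc n) = cartesianProductWith (insert zero) (allFin (suc n)) (permutations n)

-- The sample space of t independent uniformly random permutations.
permutationSequences : ∀ n t → List (Vec (Permutation′ n) t)
permutationSequences n zero    = [] ∷ []
permutationSequences n (suc t) =
  cartesianProductWith _∷_ (permutations n) (permutationSequences n t)

-- Weights of the m unmarked cards.
Weights : ℕ → Set
Weights m = Fin m → ℚ

IsDistribution : ∀ {m} → Weights m → Set
IsDistribution w = (∀ i → 0ℚ ≤ w i) × sum w ≡ 1ℚ

Φ : ∀ {m} → Weights m → ℚ
Φ {m} w = sum (λ i → w i ^ 2) - recip m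

-- The tracked card is the unmarked card with index zero.
w₀ : ∀ {m} → Weights m
w₀ zero    = 1ℚ
w₀ (suc _) = 0ℚ

-- M servers with K cards each, of which those in H are not corrupted, and f
-- marked cards.
module Mixnet (K M f : ℕ) (H : Subset M) where

  n : ℕ
  n = M ℕ.* K

  m : ℕ
  m = n ℕ.∸ f

  -- The server handling each unmarked card.  The cards are Fin n, the first m of
  -- them unmarked; π sends cards to positions, and position p belongs to block
  -- number ⌊ p / K ⌋.
  server : Permutation′ n → Fin m → Fin M
  server π i = quotient K (π ⟨$⟩ʳ inject≤ i (m∸n≤m n f))

  step : Weights m → Permutation′ n → Weights m
  step w π i =
    if does (server π i ∈? H)
    then mean (map w (filter (λ j → server π j ≟ server π i) (allFin m)))
    else w i

  weightsAfter : ∀ {t} → Vec (Permutation′ n) t → Weights m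
  weightsAfter = Vec.foldl′ step w₀

  𝔼Φ : ℕ → ℚ
  𝔼Φ t = mean (map (Φ ∘ weightsAfter) (permutationSequences n t))

  -- 𝔼[ΔΦ / Φ] over one round started from the weights w.
  expectedRelativeDecrease : (w : Weights m) .{{_ : Positive (Φ w)}} → ℚ
  expectedRelativeDecrease w =
    mean (map (λ π → ((Φ w - Φ (step w π)) ÷ Φ w) {{pos⇒nonZero (Φ w)}}) (permutations n))

{-# OPTIONS --safe #-}

-- One round is w ↦ P w for a random symmetric stochastic matrix P (averaging over
-- the blocks of the honest servers), so the expectation of Σ w_i(t + 1)² is a
-- quadratic form in w(t).  The law of the round is invariant under permuting the
-- unmarked cards, hence so is the form: its matrix has one value on the diagonal and
-- one off it.  On weights of sum 1 it therefore equals δ Σ w_i² + e, and the uniform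
-- weights, which every round fixes, determine e; this gives 𝔼[Φ(t + 1)] = δ Φ(t)
-- with δ = 1 - γ, and so 𝔼[Φ(t)] = δ ^ t (1 - 1 / m).
--
-- For the three bounds, suppose 𝔼[Φ(t)] > n ^ (- b).  Then there is already a
-- positive rational ρ = j / k < b with 𝔼[Φ(t)] > n ^ (- ρ), and clearing roots this
-- says that t k / j lies below log n (below c, respectively), so that t is smaller
-- than the real number of which it is the ceiling.

module Submission where

open import Defs
open import Algebra.Bundles using (CommutativeRing)
open import Data.Bool.Base using (Bool; true; false; if_then_else_; _∧_)
open import Data.Empty using (⊥; ⊥-elim)
open import Data.Fin.Base using (Fin; zero; suc; punchIn; inject≤; quotient)
open import Data.Fin.Permutation as Perm
  using (Permutation′; _⟨$⟩ʳ_; _⟨$⟩ˡ_; _∘ₚ_; insert; remove; transpose; _≈_)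
open import Data.Fin.Properties using (_≟_; all?; punchIn-injective; inject≤-injective)
open import Data.Fin.Subset using (Subset; ∣_∣)
open import Data.Fin.Subset.Properties using (_∈?_)
open import Data.Integer.Base as ℤ using (-[1+_])
import Data.Integer.Properties as ℤ
open import Data.List.Base
  using (List; []; _∷_; _++_; map; foldr; filter; length; allFin; tabulate; cartesianProductWith)
open import Data.List.Membership.Propositional using (_∈_)
open import Data.List.Membership.Propositional.Properties
  using (∈-filter⁺; ∈-allFin; ∈-cartesianProductWith⁺)
open import Data.List.Properties using (map-tabulate; length-map; map-∘)
open import Data.List.Relation.Unary.Any using (here)
open import Data.Nat.Base as ℕ using (ℕ; zero; suc)
import Data.Nat.Properties as ℕ
open import Data.Product.Base using (∃-syntax; _×_; _,_; proj₁; proj₂)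
open import Data.Rational.Base hiding (∣_∣)
open import Data.Rational.Properties hiding (_≟_)
import Data.Rational.Properties as ℚ
import Data.Rational.Unnormalised.Base as ℚᵘ
import Data.Rational.Unnormalised.Properties as ℚᵘ
open import Data.Sum.Base using (_⊎_; inj₁; inj₂; [_,_]′)
open import Data.Vec.Base as Vec using ([]; _∷_)
open import Algebra.Definitions.RawSemiring +-*-rawSemiring using (_^_; sum)
open import Algebra.Properties.CommutativeSemiring.Exp
  (CommutativeRing.commutativeSemiring +-*-commutativeRing) using (^-distrib-*)
open import Algebra.Properties.Group +-0-group using () renaming (⁻¹-involutive to neg-involutive)
open import Algebra.Properties.Semiring.Exp (CommutativeRing.semiring +-*-commutativeRing)
  using (^-homo-*; ^-assocʳ)
open import Algebra.Properties.Semiring.Sum (CommutativeRing.semiring +-*-commutativeRing)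
  using (sum-cong-≗; ∑-comm; ∑-distrib-+; sum-permute; *-distribˡ-sum; *-distribʳ-sum)
open import Function.Base using (_∘_; id)
open import Function.Bundles using (_⇔_; mk⇔; Equivalence; Injection)
open import Function.Properties.Inverse using (↔⇒↣)
open import Level using (Level)
open import Relation.Binary.PropositionalEquality
  using (_≡_; _≢_; refl; sym; trans; cong; cong₂; subst; subst₂; module ≡-Reasoning)
open import Relation.Nullary.Decidable
  using (Dec; does; yes; no; does-⇔; _×-dec_; dec-true; dec-false; dec⇒maybe)
open import Relation.Unary using (Pred; Decidable)
open import Tactic.RingSolver using (solve-∀)
open import Tactic.RingSolver.Core.AlmostCommutativeRing
  using (AlmostCommutativeRing; fromCommutativeRing)

-- Each conclusion `≤ᴿ` is a negation, so its proof starts from a rational `q` strictly between the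
-- claimed bound and `𝔼Φ t`; what follows is arithmetic with integer powers of rationals. Existence
-- of roots and continuity of powers are never proved, hence every strict inequality between cuts
-- has to be witnessed by an explicit rational. In the logarithmic bounds roundedness of `b`
-- provides it. The bound with exponent `- 1 / c` requires one more, a rational below `δ` and above
-- a root of a power of `n`; the factor `1 - 1 / m`, the potential at the start, supplies it. There
-- `c` must also be compared with a rational, which is constructively possible only across a gap:
-- `located` is applied to two nearby rationals. Invariance under relabelling meets another
-- obstacle. Permutations are records of functions, and a composite agrees with a listed permutation
-- only up to the pointwise equality `≈`. Sums over all permutations are therefore re-indexed by
-- counting with indicators.

ring : AlmostCommutativeRing _ _
ring = fromCommutativeRing +-*-commutativeRing (λ x → dec⇒maybe (0ℚ ℚ.≟ x))

-- Naturals and powers in ℚ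

toℚᵘ-fromℕ : ∀ n → toℚᵘ (fromℕ n) ℚᵘ.≃ ℚᵘ.mkℚᵘ (ℤ.+ n) 0
toℚᵘ-fromℕ n = toℚᵘ-fromℚᵘ (ℚᵘ.mkℚᵘ (ℤ.+ n) 0)

fromℕ-+ : ∀ a b → fromℕ (a ℕ.+ b) ≡ fromℕ a + fromℕ b
fromℕ-+ a b = toℚᵘ-injective (begin
  toℚᵘ (fromℕ (a ℕ.+ b))                        ≈⟨ toℚᵘ-fromℕ (a ℕ.+ b) ⟩
  ℚᵘ.mkℚᵘ (ℤ.+ (a ℕ.+ b)) 0                       ≡⟨ cong (λ z → ℚᵘ.mkℚᵘ z 0) (sym (cong₂ ℤ._+_ (ℤ.*-identityʳ (ℤ.+ a)) (ℤ.*-identityʳ (ℤ.+ b)))) ⟩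
  ℚᵘ.mkℚᵘ (ℤ.+ a) 0 ℚᵘ.+ ℚᵘ.mkℚᵘ (ℤ.+ b) 0          ≈⟨ ℚᵘ.+-cong (toℚᵘ-fromℕ a) (toℚᵘ-fromℕ b) ⟨
  toℚᵘ (fromℕ a) ℚᵘ.+ toℚᵘ (fromℕ b)            ≈⟨ toℚᵘ-homo-+ (fromℕ a) (fromℕ b) ⟨
  toℚᵘ (fromℕ a + fromℕ b)                      ∎)
  where open ℚᵘ.≃-Reasoning

fromℕ-* : ∀ a b → fromℕ (a ℕ.* b) ≡ fromℕ a * fromℕ b
fromℕ-* zero    b = sym (*-zeroˡ (fromℕ b))
fromℕ-* (suc a) b = begin
  fromℕ (b ℕ.+ a ℕ.* b)              ≡⟨ fromℕ-+ b (a ℕ.* b) ⟩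
  fromℕ b + fromℕ (a ℕ.* b)          ≡⟨ cong (fromℕ b +_) (fromℕ-* a b) ⟩
  fromℕ b + fromℕ a * fromℕ b        ≡⟨ lem (fromℕ a) (fromℕ b) ⟩
  (1ℚ + fromℕ a) * fromℕ b           ≡⟨ cong (_* fromℕ b) (fromℕ-+ 1 a) ⟨
  fromℕ (suc a) * fromℕ b            ∎
  where
  open ≡-Reasoning
  lem : ∀ x y → y + x * y ≡ (1ℚ + x) * y
  lem = solve-∀ ring

fromℕ-pos : ∀ n → Positive (fromℕ (suc n))
fromℕ-pos n = normalize-pos (suc n) 1

fromℕ-nonNeg : ∀ n → NonNegative (fromℕ n)
fromℕ-nonNeg n = normalize-nonNeg n 1

fromℕ-mono-≤ : ∀ {a b} → a ℕ.≤ b → fromℕ a ≤ fromℕ b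
fromℕ-mono-≤ {a} {b} a≤b = subst (fromℕ a ≤_) eq
  (p≤p+q {fromℕ a} {fromℕ (b ℕ.∸ a)})
  where
  instance _ = fromℕ-nonNeg (b ℕ.∸ a)
  p≤p+q : ∀ {p q} .{{_ : NonNegative q}} → p ≤ p + q
  p≤p+q {p} {q} = subst (_≤ p + q) (+-identityʳ p) (+-monoʳ-≤ p (nonNegative⁻¹ q))
  eq : fromℕ a + fromℕ (b ℕ.∸ a) ≡ fromℕ b
  eq = trans (sym (fromℕ-+ a (b ℕ.∸ a))) (cong fromℕ (ℕ.m+[n∸m]≡n a≤b))

fromℕ-recip : ∀ n → fromℕ (suc n) * recip (suc n) ≡ 1ℚ
fromℕ-recip n = toℚᵘ-injective (begin
  toℚᵘ (fromℕ (suc n) * recip (suc n))              ≈⟨ toℚᵘ-homo-* (fromℕ (suc n)) (recip (suc n)) ⟩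
  toℚᵘ (fromℕ (suc n)) ℚᵘ.* toℚᵘ (recip (suc n))    ≈⟨ ℚᵘ.*-cong (toℚᵘ-fromℕ (suc n)) (toℚᵘ-fromℚᵘ (ℚᵘ.mkℚᵘ (ℤ.+ 1) n)) ⟩
  ℚᵘ.mkℚᵘ (ℤ.+ suc n) 0 ℚᵘ.* ℚᵘ.mkℚᵘ (ℤ.+ 1) n          ≈⟨ ℚᵘ.*≡* (trans (ℤ.*-identityʳ (ℤ.+ suc n ℤ.* ℤ.+ 1)) (trans (ℤ.*-identityʳ (ℤ.+ suc n)) (sym (trans (ℤ.*-identityˡ _) (ℤ.*-identityˡ (ℤ.+ suc n)))))) ⟩
  toℚᵘ 1ℚ                                           ∎)
  where open ℚᵘ.≃-Reasoning

0<1 : 0ℚ < 1ℚ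
0<1 = positive⁻¹ 1ℚ

*-mono-≤-nonNeg : ∀ {p q r s} → 0ℚ ≤ p → 0ℚ ≤ s → p ≤ q → r ≤ s → p * r ≤ q * s
*-mono-≤-nonNeg {p} {q} {r} {s} 0≤p 0≤s p≤q r≤s = ≤-trans
  (*-monoˡ-≤-nonNeg p {{nonNegative 0≤p}} r≤s)
  (*-monoʳ-≤-nonNeg s {{nonNegative 0≤s}} p≤q)

*-pos : ∀ {p q} → 0ℚ < p → 0ℚ < q → 0ℚ < p * q
*-pos {p} {q} 0<p 0<q =
  positive⁻¹ (p * q) {{pos*pos⇒pos p {{positive 0<p}} q {{positive 0<q}}}}

*-nonNeg : ∀ {p q} → 0ℚ ≤ p → 0ℚ ≤ q → 0ℚ ≤ p * q
*-nonNeg {p} {q} 0≤p 0≤q =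
  nonNegative⁻¹ (p * q) {{nonNeg*nonNeg⇒nonNeg p {{nonNegative 0≤p}} q {{nonNegative 0≤q}}}}

^-nonNeg : ∀ {x} n → 0ℚ ≤ x → 0ℚ ≤ x ^ n
^-nonNeg zero    0≤x = <⇒≤ 0<1
^-nonNeg (suc n) 0≤x = *-nonNeg 0≤x (^-nonNeg n 0≤x)

^-pos : ∀ {x} n → 0ℚ < x → 0ℚ < x ^ n
^-pos zero    0<x = 0<1
^-pos (suc n) 0<x = *-pos 0<x (^-pos n 0<x)

^-mono-≤ : ∀ {x y} n → 0ℚ ≤ x → x ≤ y → x ^ n ≤ y ^ n
^-mono-≤ zero    0≤x x≤y = ≤-refl
^-mono-≤ (suc n) 0≤x x≤y =
  *-mono-≤-nonNeg 0≤x (^-nonNeg n (≤-trans 0≤x x≤y)) x≤y (^-mono-≤ n 0≤x x≤y)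

^-mono-< : ∀ {x y} n → 0ℚ ≤ x → x < y → x ^ suc n < y ^ suc n
^-mono-< {x} {y} n 0≤x x<y = ≤-<-trans
  (*-monoˡ-≤-nonNeg x {{nonNegative 0≤x}} (^-mono-≤ n 0≤x (<⇒≤ x<y)))
  (*-monoˡ-<-pos (y ^ n) {{positive (^-pos n (≤-<-trans 0≤x x<y))}} x<y)

^-cancel-< : ∀ {x y} n → 0ℚ ≤ y → x ^ n < y ^ n → x < y
^-cancel-< n 0≤y lt = ≰⇒> λ y≤x → <-irrefl refl (<-≤-trans lt (^-mono-≤ n 0≤y y≤x))

1^n≡1 : ∀ n → 1ℚ ^ n ≡ 1ℚ
1^n≡1 zero    = refl
1^n≡1 (suc n) = trans (*-identityˡ (1ℚ ^ n)) (1^n≡1 n)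

1≤^ : ∀ {x} n → 1ℚ ≤ x → 1ℚ ≤ x ^ n
1≤^ {x} n 1≤x = subst (_≤ x ^ n) (1^n≡1 n) (^-mono-≤ n (<⇒≤ 0<1) 1≤x)

1<^ : ∀ {x} n → 1ℚ < x → 1ℚ < x ^ suc n
1<^ {x} n 1<x = subst (_< x ^ suc n) (1^n≡1 (suc n)) (^-mono-< n (<⇒≤ 0<1) 1<x)

^-^-comm : ∀ x a b → (x ^ a) ^ b ≡ (x ^ b) ^ a
^-^-comm x a b = begin
  (x ^ a) ^ b    ≡⟨ ^-assocʳ x a b ⟩
  x ^ (a ℕ.* b)  ≡⟨ cong (x ^_) (ℕ.*-comm a b) ⟩
  x ^ (b ℕ.* a)  ≡⟨ ^-assocʳ x b a ⟨
  (x ^ b) ^ a    ∎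
  where open ≡-Reasoning

p<q⇒0<q-p : ∀ {p q} → p < q → 0ℚ < q - p
p<q⇒0<q-p {p} {q} p<q = subst (_< q - p) (+-inverseʳ p) (+-monoˡ-< (- p) p<q)

p≤q⇒0≤q-p : ∀ {p q} → p ≤ q → 0ℚ ≤ q - p
p≤q⇒0≤q-p {p} {q} p≤q = subst (_≤ q - p) (+-inverseʳ p) (+-monoˡ-≤ (- p) p≤q)

0≤q-p⇒p≤q : ∀ {p q} → 0ℚ ≤ q - p → p ≤ q
0≤q-p⇒p≤q {p} {q} h = subst₂ _≤_ (+-identityʳ p) (lem p q) (+-monoʳ-≤ p h)
  where
  lem : ∀ p q → p + (q - p) ≡ q
  lem = solve-∀ ring

0<q-p⇒p<q : ∀ {p q} → 0ℚ < q - p → p < q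
0<q-p⇒p<q {p} {q} h = subst₂ _<_ (+-identityʳ p) (lem p q) (+-monoʳ-< p h)
  where
  lem : ∀ p q → p + (q - p) ≡ q
  lem = solve-∀ ring

-- The inductive step gives away exactly `n * ε * ε`. The inequality serves to absorb the factor
-- `1 - 1 / m` of `𝔼Φ t` into a `t`-th power.
bernoulli : ∀ {ε} n → 0ℚ ≤ ε → ε ≤ 1ℚ → 1ℚ - fromℕ n * ε ≤ (1ℚ - ε) ^ n
bernoulli {ε} zero    0≤ε ε≤1 = ≤-reflexive (lem ε)
  where
  lem : ∀ x → 1ℚ - 0ℚ * x ≡ 1ℚ
  lem = solve-∀ ring
bernoulli {ε} (suc n) 0≤ε ε≤1 = begin
  1ℚ - fromℕ (suc n) * ε          ≡⟨ cong (λ z → 1ℚ - z * ε) (fromℕ-+ 1 n) ⟩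
  1ℚ - (1ℚ + fromℕ n) * ε         ≤⟨ 0≤q-p⇒p≤q (subst (0ℚ ≤_) (lem ε (fromℕ n))
                                       (*-nonNeg (nonNegative⁻¹ (fromℕ n) {{fromℕ-nonNeg n}}) (*-nonNeg 0≤ε 0≤ε))) ⟩
  (1ℚ - ε) * (1ℚ - fromℕ n * ε)   ≤⟨ *-monoˡ-≤-nonNeg (1ℚ - ε) {{nonNegative (p≤q⇒0≤q-p ε≤1)}} (bernoulli n 0≤ε ε≤1) ⟩
  (1ℚ - ε) * (1ℚ - ε) ^ n         ∎
  where
  open ≤-Reasoning
  lem : ∀ x k → k * (x * x) ≡ (1ℚ - x) * (1ℚ - k * x) - (1ℚ - (1ℚ + k) * x)
  lem = solve-∀ ring

1<2 : 1ℚ < fromℕ 2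
1<2 = 0<q-p⇒p<q (positive⁻¹ (fromℕ 2 - 1ℚ))

p+p≡2*p : ∀ p → p + p ≡ fromℕ 2 * p
p+p≡2*p p = trans (cong₂ _+_ (sym (*-identityˡ p)) (sym (*-identityˡ p))) (sym (*-distribʳ-+ p 1ℚ 1ℚ))

n<x^n : ∀ {x} n → fromℕ 2 ≤ x → fromℕ n < x ^ n
n<x^n {x} zero    2≤x = 0<1
n<x^n {x} (suc n) 2≤x = begin-strict
  fromℕ (suc n)        ≡⟨ fromℕ-+ 1 n ⟩
  1ℚ + fromℕ n         <⟨ +-mono-≤-< (1≤^ n (≤-trans (<⇒≤ (1<2)) 2≤x)) (n<x^n n 2≤x) ⟩
  x ^ n + x ^ n        ≡⟨ p+p≡2*p (x ^ n) ⟩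
  fromℕ 2 * x ^ n      ≤⟨ *-monoʳ-≤-nonNeg (x ^ n) {{nonNegative (^-nonNeg n (≤-trans (nonNegative⁻¹ (fromℕ 2)) 2≤x))}} 2≤x ⟩
  x * x ^ n            ∎
  where
  open ≤-Reasoning

archimedean : ∀ x → ∃[ k ] x ≤ fromℕ k
archimedean x@(mkℚ n d _) = ℤ.∣ n ∣ , toℚᵘ-cancel-≤ (ℚᵘ.≤-respʳ-≃ (ℚᵘ.≃-sym (toℚᵘ-fromℕ ℤ.∣ n ∣)) (ℚᵘ.*≤* (begin
  n ℤ.* ℤ.+ 1                     ≡⟨ ℤ.*-identityʳ n ⟩
  n                               ≤⟨ i≤∣i∣ n ⟩
  ℤ.+ ℤ.∣ n ∣                     ≤⟨ ℤ.+≤+ (ℕ.m≤m*n ℤ.∣ n ∣ (suc d)) ⟩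
  ℤ.+ (ℤ.∣ n ∣ ℕ.* suc d)         ≡⟨ ℤ.pos-* ℤ.∣ n ∣ (suc d) ⟩
  ℤ.+ ℤ.∣ n ∣ ℤ.* ℤ.+ suc d       ∎)))
  where
  open ℤ.≤-Reasoning
  i≤∣i∣ : ∀ i → i ℤ.≤ ℤ.+ ℤ.∣ i ∣
  i≤∣i∣ (ℤ.+ n)   = ℤ.≤-refl
  i≤∣i∣ -[1+ n ]  = ℤ.-≤+

-- Finite sums

private variable
  a b c : Level
  A : Set a
  B : Set b
  C : Set c

∑ : List A → (A → ℚ) → ℚ
∑ xs f = foldr _+_ 0ℚ (map f xs)

∑-cong : ∀ (xs : List A) {f g : A → ℚ} → (∀ x → f x ≡ g x) → ∑ xs f ≡ ∑ xs g
∑-cong []       f≗g = refl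
∑-cong (x ∷ xs) f≗g = cong₂ _+_ (f≗g x) (∑-cong xs f≗g)

∑-zero : ∀ (xs : List A) → ∑ xs (λ _ → 0ℚ) ≡ 0ℚ
∑-zero []       = refl
∑-zero (x ∷ xs) = trans (+-identityˡ _) (∑-zero xs)

∑-+ : ∀ (xs : List A) (f g : A → ℚ) → ∑ xs (λ x → f x + g x) ≡ ∑ xs f + ∑ xs g
∑-+ []       f g = refl
∑-+ (x ∷ xs) f g = trans (cong (_+_ (f x + g x)) (∑-+ xs f g)) (lem (f x) (g x) (∑ xs f) (∑ xs g))
  where
  lem : ∀ a b c d → (a + b) + (c + d) ≡ (a + c) + (b + d)
  lem = solve-∀ ring

∑-*ˡ : ∀ (xs : List A) k (f : A → ℚ) → ∑ xs (λ x → k * f x) ≡ k * ∑ xs f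
∑-*ˡ []       k f = sym (*-zeroʳ k)
∑-*ˡ (x ∷ xs) k f = trans (cong (_+_ (k * f x)) (∑-*ˡ xs k f)) (sym (*-distribˡ-+ k (f x) (∑ xs f)))

∑-*ʳ : ∀ (xs : List A) k (f : A → ℚ) → ∑ xs (λ x → f x * k) ≡ ∑ xs f * k
∑-*ʳ xs k f = begin
  ∑ xs (λ x → f x * k)  ≡⟨ ∑-cong xs (λ x → *-comm (f x) k) ⟩
  ∑ xs (λ x → k * f x)  ≡⟨ ∑-*ˡ xs k f ⟩
  k * ∑ xs f            ≡⟨ *-comm k (∑ xs f) ⟩
  ∑ xs f * k            ∎
  where open ≡-Reasoning

∑-comm-list : ∀ (xs : List A) (ys : List B) (f : A → B → ℚ) →
  ∑ xs (λ x → ∑ ys (f x)) ≡ ∑ ys (λ y → ∑ xs (λ x → f x y))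
∑-comm-list []       ys f = sym (∑-zero ys)
∑-comm-list (x ∷ xs) ys f = trans (cong (_+_ (∑ ys (f x))) (∑-comm-list xs ys f))
  (sym (∑-+ ys (f x) (λ y → ∑ xs (λ x → f x y))))

∑-comm-sum : ∀ (xs : List A) {n} (f : A → Fin n → ℚ) →
  ∑ xs (λ x → sum (f x)) ≡ sum (λ i → ∑ xs (λ x → f x i))
∑-comm-sum xs {zero}  f = ∑-zero xs
∑-comm-sum xs {suc n} f = trans (∑-+ xs (λ x → f x zero) (λ x → sum (f x ∘ suc)))
  (cong (_+_ (∑ xs (λ x → f x zero))) (∑-comm-sum xs (λ x → f x ∘ suc)))

∑-++ : ∀ (xs ys : List A) f → ∑ (xs ++ ys) f ≡ ∑ xs f + ∑ ys f
∑-++ []       ys f = sym (+-identityˡ _)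
∑-++ (x ∷ xs) ys f = trans (cong (_+_ (f x)) (∑-++ xs ys f)) (sym (+-assoc (f x) (∑ xs f) (∑ ys f)))

∑-cartesianProductWith : ∀ (_∙_ : A → B → C) xs ys f →
  ∑ (cartesianProductWith _∙_ xs ys) f ≡ ∑ xs (λ x → ∑ ys (λ y → f (x ∙ y)))
∑-cartesianProductWith _∙_ []       ys f = refl
∑-cartesianProductWith _∙_ (x ∷ xs) ys f = trans
  (∑-++ (map (x ∙_) ys) (cartesianProductWith _∙_ xs ys) f)
  (cong₂ _+_ (cong (foldr _+_ 0ℚ) (sym (map-∘ ys))) (∑-cartesianProductWith _∙_ xs ys f))

∑-allFin : ∀ n (f : Fin n → ℚ) → ∑ (allFin n) f ≡ sum f
∑-allFin n f = trans (cong (foldr _+_ 0ℚ) (map-tabulate id f)) (∑-tabulate n f)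
  where
  ∑-tabulate : ∀ n (f : Fin n → ℚ) → foldr _+_ 0ℚ (tabulate f) ≡ sum f
  ∑-tabulate zero    f = refl
  ∑-tabulate (suc n) f = cong (_+_ (f zero)) (∑-tabulate n (f ∘ suc))

𝟙 : Bool → ℚ
𝟙 b = if b then 1ℚ else 0ℚ

𝟙-∧ : ∀ x y → 𝟙 (x ∧ y) ≡ 𝟙 x * 𝟙 y
𝟙-∧ true  y = sym (*-identityˡ (𝟙 y))
𝟙-∧ false y = sym (*-zeroˡ (𝟙 y))

𝟙-absorb : ∀ {p} {P : Set p} (P? : Dec P) {x y} → (P → x ≡ y) → 𝟙 (does P?) * x ≡ 𝟙 (does P?) * y
𝟙-absorb (yes p) x≡y = cong (1ℚ *_) (x≡y p)
𝟙-absorb (no _) {x} {y} _ = trans (*-zeroˡ x) (sym (*-zeroˡ y))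

∑-filter : ∀ {p} {P : Pred A p} (P? : Decidable P) xs (f : A → ℚ) →
  ∑ (filter P? xs) f ≡ ∑ xs (λ x → 𝟙 (does (P? x)) * f x)
∑-filter P? []       f = refl
∑-filter P? (x ∷ xs) f with does (P? x)
... | true  = cong₂ _+_ (sym (*-identityˡ (f x))) (∑-filter P? xs f)
... | false = trans (∑-filter P? xs f) (sym (trans (cong (_+ _) (*-zeroˡ (f x))) (+-identityˡ _)))

∑-length : ∀ (xs : List A) → ∑ xs (λ _ → 1ℚ) ≡ fromℕ (length xs)
∑-length []       = refl
∑-length (x ∷ xs) = trans (cong (_+_ 1ℚ) (∑-length xs)) (sym (fromℕ-+ 1 (length xs)))

mean-map : ∀ (xs : List A) f → mean (map f xs) ≡ ∑ xs f * recip (length xs)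
mean-map xs f = cong (λ k → ∑ xs f * recip k) (length-map f xs)

sum-δ : ∀ {n} (i : Fin n) (f : Fin n → ℚ) → sum (λ j → 𝟙 (does (j ≟ i)) * f j) ≡ f i
sum-δ {suc n} zero f = trans (cong₂ _+_ (*-identityˡ (f zero)) (trans (sum-cong-≗ {n} (λ j → *-zeroˡ (f (suc j)))) (sum-zero n))) (+-identityʳ _)
  where
  sum-zero : ∀ n → sum {n} (λ _ → 0ℚ) ≡ 0ℚ
  sum-zero zero    = refl
  sum-zero (suc n) = trans (+-identityˡ _) (sum-zero n)
sum-δ (suc i) f = trans (cong₂ _+_ (*-zeroˡ (f zero)) (sum-δ i (f ∘ suc))) (+-identityˡ _)

sum-1 : ∀ n → sum {n} (λ _ → 1ℚ) ≡ fromℕ n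
sum-1 zero    = refl
sum-1 (suc n) = trans (cong (_+_ 1ℚ) (sum-1 n)) (sym (fromℕ-+ 1 n))

-- Sums over all permutations

_≈?_ : ∀ {n} (π ρ : Permutation′ n) → Dec (π ≈ ρ)
π ≈? ρ = all? (λ i → π ⟨$⟩ʳ i ≟ ρ ⟨$⟩ʳ i)

insert≈⇔ : ∀ {n} j (π : Permutation′ n) ρ →
  (insert zero j π ≈ ρ) ⇔ (j ≡ ρ ⟨$⟩ʳ zero × π ≈ remove zero ρ)
insert≈⇔ j π ρ = mk⇔ to from
  where
  open ≡-Reasoning
  to : insert zero j π ≈ ρ → j ≡ ρ ⟨$⟩ʳ zero × π ≈ remove zero ρ
  to eq = eq zero , λ i → punchIn-injective j _ _ (begin
    punchIn j (π ⟨$⟩ʳ i)                              ≡⟨ Perm.insert-punchIn zero j π i ⟨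
    insert zero j π ⟨$⟩ʳ suc i                        ≡⟨ eq (suc i) ⟩
    ρ ⟨$⟩ʳ suc i                                      ≡⟨ Perm.punchIn-permute ρ zero i ⟩
    punchIn (ρ ⟨$⟩ʳ zero) (remove zero ρ ⟨$⟩ʳ i)      ≡⟨ cong (λ k → punchIn k (remove zero ρ ⟨$⟩ʳ i)) (eq zero) ⟨
    punchIn j (remove zero ρ ⟨$⟩ʳ i)                  ∎)
  from : j ≡ ρ ⟨$⟩ʳ zero × π ≈ remove zero ρ → insert zero j π ≈ ρ
  from (j≡ , eq) zero    = j≡
  from (j≡ , eq) (suc i) = begin
    insert zero j π ⟨$⟩ʳ suc i                        ≡⟨ Perm.insert-punchIn zero j π i ⟩
    punchIn j (π ⟨$⟩ʳ i)                              ≡⟨ cong₂ punchIn j≡ (eq i) ⟩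
    punchIn (ρ ⟨$⟩ʳ zero) (remove zero ρ ⟨$⟩ʳ i)      ≡⟨ Perm.punchIn-permute ρ zero i ⟨
    ρ ⟨$⟩ʳ suc i                                      ∎

-- The indicator of `insert zero j π ≈ ρ` factors into one for `j` and one for `π`, so the induction
-- picks a single `j` and then a single `π`. The result acts as a partition of unity when sums are
-- re-indexed.
permutations-count : ∀ n (ρ : Permutation′ n) → ∑ (permutations n) (λ π → 𝟙 (does (π ≈? ρ))) ≡ 1ℚ
permutations-count zero    ρ = refl
permutations-count (suc n) ρ = begin
  ∑ (permutations (suc n)) (λ π → 𝟙 (does (π ≈? ρ)))
    ≡⟨ ∑-cartesianProductWith (insert zero) (allFin (suc n)) (permutations n) _ ⟩
  ∑ (allFin (suc n)) (λ j → ∑ (permutations n) (λ π → 𝟙 (does (insert zero j π ≈? ρ))))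
    ≡⟨ ∑-cong (allFin (suc n)) (λ j → ∑-cong (permutations n) (split j)) ⟩
  ∑ (allFin (suc n)) (λ j → ∑ (permutations n) (λ π → 𝟙 (does (j ≟ ρ₀)) * 𝟙 (does (π ≈? ρ/0))))
    ≡⟨ ∑-cong (allFin (suc n)) (λ j → trans (∑-*ˡ (permutations n) (𝟙 (does (j ≟ ρ₀))) _) (cong (𝟙 (does (j ≟ ρ₀)) *_) (permutations-count n ρ/0))) ⟩
  ∑ (allFin (suc n)) (λ j → 𝟙 (does (j ≟ ρ₀)) * 1ℚ)
    ≡⟨ ∑-allFin (suc n) (λ j → 𝟙 (does (j ≟ ρ₀)) * 1ℚ) ⟩
  sum (λ j → 𝟙 (does (j ≟ ρ₀)) * 1ℚ)
    ≡⟨ sum-δ ρ₀ (λ _ → 1ℚ) ⟩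
  1ℚ ∎
  where
  open ≡-Reasoning
  ρ₀ = ρ ⟨$⟩ʳ zero
  ρ/0 = remove zero ρ
  split : ∀ j π → 𝟙 (does (insert zero j π ≈? ρ)) ≡ 𝟙 (does (j ≟ ρ₀)) * 𝟙 (does (π ≈? ρ/0))
  split j π = trans
    (cong 𝟙 (does-⇔ (insert≈⇔ j π ρ) (insert zero j π ≈? ρ) (j ≟ ρ₀ ×-dec π ≈? ρ/0)))
    (𝟙-∧ (does (j ≟ ρ₀)) (does (π ≈? ρ/0)))

∘ₚ-≈⇔ : ∀ {n} (π ρ σ : Permutation′ n) → (ρ ≈ (σ ∘ₚ π)) ⇔ (π ≈ (Perm.flip σ ∘ₚ ρ))
∘ₚ-≈⇔ π ρ σ = mk⇔
  (λ eq i → trans (cong (π ⟨$⟩ʳ_) (sym (Perm.inverseʳ σ))) (sym (eq (σ ⟨$⟩ˡ i))))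
  (λ eq i → trans (cong (ρ ⟨$⟩ʳ_) (sym (Perm.inverseˡ σ))) (sym (eq (σ ⟨$⟩ʳ i))))

-- Double counting of the pairs `(π , ρ)` with `ρ ≈ σ ∘ₚ π`: by `permutations-count` each `π` has
-- exactly one such `ρ`, and, after moving `σ` to the other side, each `ρ` exactly one such `π`.
∑-permutations-∘ₚ : ∀ {n} (σ : Permutation′ n) (g : Permutation′ n → ℚ) →
  (∀ {π ρ} → π ≈ ρ → g π ≡ g ρ) →
  ∑ (permutations n) (λ π → g (σ ∘ₚ π)) ≡ ∑ (permutations n) g
∑-permutations-∘ₚ {n} σ g g-cong = begin
  ∑ S (λ π → g (σ ∘ₚ π))
    ≡⟨ ∑-cong S (λ π → trans (sym (*-identityˡ _)) (cong (_* g (σ ∘ₚ π)) (sym (permutations-count n (σ ∘ₚ π))))) ⟩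
  ∑ S (λ π → ∑ S (λ ρ → 𝟙 (does (ρ ≈? (σ ∘ₚ π)))) * g (σ ∘ₚ π))
    ≡⟨ ∑-cong S (λ π → sym (∑-*ʳ S (g (σ ∘ₚ π)) _)) ⟩
  ∑ S (λ π → ∑ S (λ ρ → 𝟙 (does (ρ ≈? (σ ∘ₚ π))) * g (σ ∘ₚ π)))
    ≡⟨ ∑-comm-list S S _ ⟩
  ∑ S (λ ρ → ∑ S (λ π → 𝟙 (does (ρ ≈? (σ ∘ₚ π))) * g (σ ∘ₚ π)))
    ≡⟨ ∑-cong S (λ ρ → ∑-cong S (λ π → 𝟙-absorb (ρ ≈? (σ ∘ₚ π)) (λ eq → sym (g-cong eq)))) ⟩
  ∑ S (λ ρ → ∑ S (λ π → 𝟙 (does (ρ ≈? (σ ∘ₚ π))) * g ρ))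
    ≡⟨ ∑-cong S (λ ρ → ∑-*ʳ S (g ρ) _) ⟩
  ∑ S (λ ρ → ∑ S (λ π → 𝟙 (does (ρ ≈? (σ ∘ₚ π)))) * g ρ)
    ≡⟨ ∑-cong S (λ ρ → cong (_* g ρ) (∑-cong S (λ π →
         cong 𝟙 (does-⇔ (∘ₚ-≈⇔ π ρ σ) (ρ ≈? (σ ∘ₚ π)) (π ≈? (Perm.flip σ ∘ₚ ρ)))))) ⟩
  ∑ S (λ ρ → ∑ S (λ π → 𝟙 (does (π ≈? (Perm.flip σ ∘ₚ ρ)))) * g ρ)
    ≡⟨ ∑-cong S (λ ρ → trans (cong (_* g ρ) (permutations-count n (Perm.flip σ ∘ₚ ρ))) (*-identityˡ (g ρ))) ⟩
  ∑ S g ∎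
  where
  open ≡-Reasoning
  S = permutations n

fromℕ-injective : ∀ {a b} → fromℕ a ≡ fromℕ b → a ≡ b
fromℕ-injective {a} {b} eq
  with ℚᵘ.≃-trans (ℚᵘ.≃-sym (toℚᵘ-fromℕ a)) (ℚᵘ.≃-trans (toℚᵘ-cong eq) (toℚᵘ-fromℕ b))
... | ℚᵘ.*≡* a≡b = ℤ.+-injective (trans (sym (ℤ.*-identityʳ (ℤ.+ a))) (trans a≡b (ℤ.*-identityʳ (ℤ.+ b))))

-- Membership of some `x` stands for non-emptiness, which keeps `recip` away from its conventional
-- value at zero.
∑-1*recip : ∀ {A : Set} {x : A} {xs} → x ∈ xs → ∑ xs (λ _ → 1ℚ) * recip (length xs) ≡ 1ℚ
∑-1*recip {xs = y ∷ xs} _ =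
  trans (cong (_* recip (suc (length xs))) (∑-length (y ∷ xs))) (fromℕ-recip (length xs))

sum-*ˡ : ∀ {n} k (f : Fin n → ℚ) → sum (λ i → k * f i) ≡ k * sum f
sum-*ˡ k f = sym (*-distribˡ-sum k f)

sum-*ʳ : ∀ {n} k (f : Fin n → ℚ) → sum (λ i → f i * k) ≡ sum f * k
sum-*ʳ k f = sym (*-distribʳ-sum k f)

-- Averaging as a symmetric stochastic matrix

module Averaging {m M : ℕ} (H : Subset M) where

  members : (Fin m → Fin M) → Fin M → List (Fin m)
  members a v = filter (λ j → a j ≟ v) (allFin m)

  -- At `a = server π` this is `step w π` by definition. The abstraction from `π` to a block
  -- assignment `a` lets relabellings of the unmarked cards act on it.
  avg : (Fin m → Fin M) → Weights m → Weights m
  avg a w i = if does (a i ∈? H) then mean (map w (members a (a i))) else w i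

  kernel : (Fin m → Fin M) → Fin m → Fin m → ℚ
  kernel a i j =
    if does (a i ∈? H)
    then 𝟙 (does (a j ≟ a i)) * recip (length (members a (a i)))
    else 𝟙 (does (j ≟ i))

  avg-kernel : ∀ a w i → avg a w i ≡ sum (λ j → kernel a i j * w j)
  avg-kernel a w i with does (a i ∈? H)
  ... | false = sym (sum-δ i w)
  ... | true  = begin
    mean (map w (members a (a i)))           ≡⟨ mean-map (members a (a i)) w ⟩
    ∑ (members a (a i)) w * r                ≡⟨ cong (_* r) (∑-filter (λ j → a j ≟ a i) (allFin m) w) ⟩
    ∑ (allFin m) (λ j → e j * w j) * r       ≡⟨ cong (_* r) (∑-allFin m (λ j → e j * w j)) ⟩
    sum (λ j → e j * w j) * r                ≡⟨ sum-*ʳ r (λ j → e j * w j) ⟨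
    sum (λ j → e j * w j * r)                ≡⟨ sum-cong-≗ (λ j → lem (e j) (w j) r) ⟩
    sum (λ j → e j * r * w j)                ∎
    where
    open ≡-Reasoning
    r = recip (length (members a (a i)))
    e : Fin m → ℚ
    e j = 𝟙 (does (a j ≟ a i))
    lem : ∀ x y z → x * y * z ≡ x * z * y
    lem = solve-∀ ring

  ∈-members : ∀ a i → i ∈ members a (a i)
  ∈-members a i = ∈-filter⁺ (λ j → a j ≟ a i) (∈-allFin i) refl

  avg-const : ∀ a c i → avg a (λ _ → c) i ≡ c
  avg-const a c i with does (a i ∈? H)
  ... | false = refl
  ... | true  = begin
    mean (map (λ _ → c) xs)                        ≡⟨ mean-map xs (λ _ → c) ⟩
    ∑ xs (λ _ → c) * recip (length xs)             ≡⟨ cong (_* recip (length xs)) (trans (∑-cong xs (λ _ → sym (*-identityʳ c))) (∑-*ˡ xs c (λ _ → 1ℚ))) ⟩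
    c * ∑ xs (λ _ → 1ℚ) * recip (length xs)        ≡⟨ *-assoc c _ _ ⟩
    c * (∑ xs (λ _ → 1ℚ) * recip (length xs))      ≡⟨ cong (c *_) (∑-1*recip (∈-members a i)) ⟩
    c * 1ℚ                                         ≡⟨ *-identityʳ c ⟩
    c                                              ∎
    where
    open ≡-Reasoning
    xs = members a (a i)

  sum-kernelʳ : ∀ a i → sum (kernel a i) ≡ 1ℚ
  sum-kernelʳ a i = begin
    sum (kernel a i)                 ≡⟨ sum-cong-≗ (λ j → *-identityʳ (kernel a i j)) ⟨
    sum (λ j → kernel a i j * 1ℚ)    ≡⟨ avg-kernel a (λ _ → 1ℚ) i ⟨
    avg a (λ _ → 1ℚ) i               ≡⟨ avg-const a 1ℚ i ⟩
    1ℚ                               ∎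
    where open ≡-Reasoning

  -- Two cards of one block share its honesty and its size, and cards of different blocks have entry
  -- zero both ways. Symmetry turns the row sums into column sums, so a round preserves the total
  -- weight.
  kernel-sym : ∀ a i j → kernel a i j ≡ kernel a j i
  kernel-sym a i j = by-cases (a i ≟ a j)
    where
    vanish : ∀ {i j} → a i ≢ a j → kernel a i j ≡ 0ℚ
    vanish {i} {j} ne with does (a i ∈? H)
    ... | true  = trans (cong (λ d → 𝟙 d * recip (length (members a (a i)))) (dec-false (a j ≟ a i) (λ eq → ne (sym eq))))
                        (*-zeroˡ (recip (length (members a (a i)))))
    ... | false = cong 𝟙 (dec-false (j ≟ i) (λ eq → ne (cong a (sym eq))))
    by-cases : Dec (a i ≡ a j) → kernel a i j ≡ kernel a j i
    by-cases (yes ai≡aj) = trans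
          (cong₂ (λ u d → if does (u ∈? H) then 𝟙 (does (a j ≟ u)) * recip (length (members a u)) else 𝟙 d)
            ai≡aj (does-⇔ (mk⇔ sym sym) (j ≟ i) (i ≟ j)))
          (cong (λ d → if does (a j ∈? H) then 𝟙 d * recip (length (members a (a j))) else 𝟙 (does (i ≟ j)))
            (does-⇔ (mk⇔ (λ _ → ai≡aj) (λ _ → refl)) (a j ≟ a j) (a i ≟ a j)))
    by-cases (no ai≢aj) = trans (vanish ai≢aj) (sym (vanish (λ eq → ai≢aj (sym eq))))

  sum-kernelˡ : ∀ a j → sum (λ i → kernel a i j) ≡ 1ℚ
  sum-kernelˡ a j = trans (sum-cong-≗ (λ i → kernel-sym a i j)) (sum-kernelʳ a j)

  sum-avg : ∀ a w → sum (avg a w) ≡ sum w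
  sum-avg a w = begin
    sum (avg a w)                                  ≡⟨ sum-cong-≗ (avg-kernel a w) ⟩
    sum (λ i → sum (λ j → kernel a i j * w j))     ≡⟨ ∑-comm (λ i j → kernel a i j * w j) ⟩
    sum (λ j → sum (λ i → kernel a i j * w j))     ≡⟨ sum-cong-≗ (λ j → sum-*ʳ (w j) (λ i → kernel a i j)) ⟩
    sum (λ j → sum (λ i → kernel a i j) * w j)     ≡⟨ sum-cong-≗ (λ j → trans (cong (_* w j) (sum-kernelˡ a j)) (*-identityˡ (w j))) ⟩
    sum w                                          ∎
    where open ≡-Reasoning

  -- The product of the transposed kernel with the kernel, that is, the matrix of the quadratic form
  -- sending `w` to the sum of squares of `avg a w`.
  gram : (Fin m → Fin M) → Fin m → Fin m → ℚ
  gram a j k = sum (λ i → kernel a i j * kernel a i k)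

  sum-avg-^2 : ∀ a w → sum (λ i → avg a w i ^ 2) ≡ sum (λ j → sum (λ k → gram a j k * (w j * w k)))
  sum-avg-^2 a w = begin
    sum (λ i → avg a w i ^ 2)
      ≡⟨ sum-cong-≗ expand ⟩
    sum (λ i → sum (λ j → sum (λ k → P i j * P i k * (w j * w k))))
      ≡⟨ ∑-comm (λ i j → sum (λ k → P i j * P i k * (w j * w k))) ⟩
    sum (λ j → sum (λ i → sum (λ k → P i j * P i k * (w j * w k))))
      ≡⟨ sum-cong-≗ (λ j → ∑-comm (λ i k → P i j * P i k * (w j * w k))) ⟩
    sum (λ j → sum (λ k → sum (λ i → P i j * P i k * (w j * w k))))
      ≡⟨ sum-cong-≗ (λ j → sum-cong-≗ (λ k → sum-*ʳ (w j * w k) (λ i → P i j * P i k))) ⟩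
    sum (λ j → sum (λ k → gram a j k * (w j * w k))) ∎
    where
    open ≡-Reasoning
    P = kernel a
    lem : ∀ p x q y → p * x * (q * y) ≡ p * q * (x * y)
    lem = solve-∀ ring
    expand : ∀ i → avg a w i ^ 2 ≡ sum (λ j → sum (λ k → P i j * P i k * (w j * w k)))
    expand i = begin
      avg a w i * (avg a w i * 1ℚ)
        ≡⟨ cong (avg a w i *_) (*-identityʳ (avg a w i)) ⟩
      avg a w i * avg a w i
        ≡⟨ cong₂ _*_ (avg-kernel a w i) (avg-kernel a w i) ⟩
      sum (λ j → P i j * w j) * S
        ≡⟨ sum-*ʳ S (λ j → P i j * w j) ⟨
      sum (λ j → P i j * w j * S)
        ≡⟨ sum-cong-≗ (λ j → sum-*ˡ (P i j * w j) (λ k → P i k * w k)) ⟨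
      sum (λ j → sum (λ k → P i j * w j * (P i k * w k)))
        ≡⟨ sum-cong-≗ (λ j → sum-cong-≗ (λ k → lem (P i j) (w j) (P i k) (w k))) ⟩
      sum (λ j → sum (λ k → P i j * P i k * (w j * w k))) ∎
      where S = sum (λ k → P i k * w k)

  module _ {a a′ : Fin m → Fin M} (σ : Permutation′ m) (a′≗a∘σ : ∀ i → a′ i ≡ a (σ ⟨$⟩ʳ i)) where

    private
      s : Fin m → Fin m
      s = σ ⟨$⟩ʳ_

    -- The lists themselves differ by a rearrangement. Their lengths are compared in ℚ, where a
    -- length is a sum of indicators that `sum-permute` can re-index.
    length-members : ∀ v → length (members a′ v) ≡ length (members a v)
    length-members v = fromℕ-injective (begin
      fromℕ (length (members a′ v))              ≡⟨ card a′ ⟩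
      sum (λ j → 𝟙 (does (a′ j ≟ v)) * 1ℚ)       ≡⟨ sum-cong-≗ (λ j → cong (λ u → 𝟙 (does (u ≟ v)) * 1ℚ) (a′≗a∘σ j)) ⟩
      sum (λ j → 𝟙 (does (a (s j) ≟ v)) * 1ℚ)    ≡⟨ sum-permute (λ j → 𝟙 (does (a j ≟ v)) * 1ℚ) σ ⟨
      sum (λ j → 𝟙 (does (a j ≟ v)) * 1ℚ)        ≡⟨ card a ⟨
      fromℕ (length (members a v))               ∎)
      where
      open ≡-Reasoning
      card : ∀ b → fromℕ (length (members b v)) ≡ sum (λ j → 𝟙 (does (b j ≟ v)) * 1ℚ)
      card b = trans (sym (∑-length (members b v)))
        (trans (∑-filter (λ j → b j ≟ v) (allFin m) (λ _ → 1ℚ)) (∑-allFin m (λ j → 𝟙 (does (b j ≟ v)) * 1ℚ)))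

    kernel-equivariant : ∀ i j → kernel a′ i j ≡ kernel a (s i) (s j)
    kernel-equivariant i j = trans
      (cong₂ (λ u v → entry u v (length (members a′ u)) (does (j ≟ i))) (a′≗a∘σ i) (a′≗a∘σ j))
      (cong₂ (entry (a (s i)) (a (s j))) (length-members (a (s i)))
        (does-⇔ (mk⇔ (cong s) (Injection.injective (↔⇒↣ σ))) (j ≟ i) (s j ≟ s i)))
      where
      entry : Fin M → Fin M → ℕ → Bool → ℚ
      entry u v l d = if does (u ∈? H) then 𝟙 (does (v ≟ u)) * recip l else 𝟙 d

    gram-equivariant : ∀ j k → gram a′ j k ≡ gram a (s j) (s k)
    gram-equivariant j k = begin
      sum (λ i → kernel a′ i j * kernel a′ i k)
        ≡⟨ sum-cong-≗ (λ i → cong₂ _*_ (kernel-equivariant i j) (kernel-equivariant i k)) ⟩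
      sum (λ i → kernel a (s i) (s j) * kernel a (s i) (s k))
        ≡⟨ sum-permute (λ i → kernel a i (s j) * kernel a i (s k)) σ ⟨
      sum (λ i → kernel a i (s j) * kernel a i (s k)) ∎
      where open ≡-Reasoning

-- Transpositions and matrices invariant under them

transpose-matchˡ : ∀ {n} (x y : Fin n) → transpose x y ⟨$⟩ʳ x ≡ y
transpose-matchˡ x y rewrite dec-true (x ≟ x) refl = refl

transpose-other : ∀ {n} (x y : Fin n) {k} → k ≢ x → k ≢ y → transpose x y ⟨$⟩ʳ k ≡ k
transpose-other x y {k} k≢x k≢y rewrite dec-false (k ≟ x) k≢x | dec-false (k ≟ y) k≢y = refl

transpose-matchʳ : ∀ {n} (x y : Fin n) → transpose x y ⟨$⟩ʳ y ≡ x
transpose-matchʳ x y with y ≟ x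
... | yes y≡x = y≡x
... | no  _ rewrite dec-true (y ≟ y) refl = refl

-- With `f` the inclusion of the unmarked cards, a swap of two unmarked cards is induced by a swap
-- inside `Permutation′ n`, over which the round averages.
transpose-natural : ∀ {m n} (f : Fin m → Fin n) → (∀ {i j} → f i ≡ f j → i ≡ j) →
  ∀ x y i → transpose (f x) (f y) ⟨$⟩ʳ f i ≡ f (transpose x y ⟨$⟩ʳ i)
transpose-natural f f-inj x y i = by-cases (i ≟ x) (i ≟ y)
  where
  by-cases : Dec (i ≡ x) → Dec (i ≡ y) → transpose (f x) (f y) ⟨$⟩ʳ f i ≡ f (transpose x y ⟨$⟩ʳ i)
  by-cases (yes refl) _ = trans (transpose-matchˡ (f i) (f y)) (cong f (sym (transpose-matchˡ i y)))
  by-cases (no _) (yes refl) = trans (transpose-matchʳ (f x) (f i)) (cong f (sym (transpose-matchʳ x i)))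
  by-cases (no i≢x) (no i≢y) = trans
    (transpose-other (f x) (f y) (λ eq → i≢x (f-inj eq)) (λ eq → i≢y (f-inj eq)))
    (cong f (sym (transpose-other x y i≢x i≢y)))

-- Swapping `j` with 0 carries the entry `(j , j)` to `(0 , 0)` and an off-diagonal `(j , k)` to
-- some `(0 , k′)` with `k′` nonzero; swapping `k′` with 1 fixes 0 and carries that to `(0 , 1)`. So
-- `e` is the entry at `(0 , 1)`, which exists as `m` is at least 2, and `d` is the excess of the
-- diagonal over it.
transpose-invariant : ∀ {m} → 2 ℕ.≤ m → (F : Fin m → Fin m → ℚ) →
  (∀ x y j k → F (transpose x y ⟨$⟩ʳ j) (transpose x y ⟨$⟩ʳ k) ≡ F j k) →
  ∃[ d ] ∃[ e ] (∀ j k → F j k ≡ 𝟙 (does (k ≟ j)) * d + e)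
transpose-invariant {suc (suc m)} (ℕ.s≤s (ℕ.s≤s _)) F inv =
  F 0F 0F - F 0F 1F , F 0F 1F , values
  where
  open ≡-Reasoning
  0F 1F : Fin (suc (suc m))
  0F = zero
  1F = suc zero
  lem₁ : ∀ x y → x ≡ 1ℚ * (x - y) + y
  lem₁ = solve-∀ ring
  lem₀ : ∀ x y → y ≡ 0ℚ * (x - y) + y
  lem₀ = solve-∀ ring
  diagonal : ∀ j → F j j ≡ F 0F 0F
  diagonal j = trans (sym (inv j 0F j j)) (cong₂ F (transpose-matchˡ j 0F) (transpose-matchˡ j 0F))
  off-diagonal₀ : ∀ k → k ≢ 0F → F 0F k ≡ F 0F 1F
  off-diagonal₀ k k≢0 = trans (sym (inv k 1F 0F k))
    (cong₂ F (transpose-other k 1F (λ eq → k≢0 (sym eq)) (λ ())) (transpose-matchˡ k 1F))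
  off-diagonal : ∀ j k → k ≢ j → F j k ≡ F 0F 1F
  off-diagonal j k k≢j = trans (sym (inv j 0F j k)) (trans
    (cong (λ z → F z k′) (transpose-matchˡ j 0F)) (off-diagonal₀ k′ k′≢0))
    where
    k′ = transpose j 0F ⟨$⟩ʳ k
    k′≢0 : k′ ≢ 0F
    k′≢0 eq = k≢j (Injection.injective (↔⇒↣ (transpose j 0F)) (trans eq (sym (transpose-matchˡ j 0F))))
  values : ∀ j k → F j k ≡ 𝟙 (does (k ≟ j)) * (F 0F 0F - F 0F 1F) + F 0F 1F
  values j k with k ≟ j
  ... | yes refl = trans (diagonal k) (lem₁ (F 0F 0F) (F 0F 1F))
  ... | no  k≢j  = trans (off-diagonal j k k≢j) (lem₀ (F 0F 0F) (F 0F 1F))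

quadratic-form : ∀ {m} (d e : ℚ) (w : Weights m) →
  sum (λ j → sum (λ k → (𝟙 (does (k ≟ j)) * d + e) * (w j * w k)))
    ≡ d * sum (λ j → w j ^ 2) + e * (sum w * sum w)
quadratic-form d e w = begin
  sum (λ j → sum (λ k → (𝟙 (does (k ≟ j)) * d + e) * (w j * w k)))
    ≡⟨ sum-cong-≗ inner ⟩
  sum (λ j → d * w j ^ 2 + e * sum w * w j)
    ≡⟨ ∑-distrib-+ (λ j → d * w j ^ 2) (λ j → e * sum w * w j) ⟩
  sum (λ j → d * w j ^ 2) + sum (λ j → e * sum w * w j)
    ≡⟨ cong₂ _+_ (sum-*ˡ d (λ j → w j ^ 2)) (trans (sum-*ˡ (e * sum w) w) (*-assoc e (sum w) (sum w))) ⟩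
  d * sum (λ j → w j ^ 2) + e * (sum w * sum w) ∎
  where
  open ≡-Reasoning
  lem₁ : ∀ t d e x y → (t * d + e) * (x * y) ≡ t * (d * (x * y)) + (e * x) * y
  lem₁ = solve-∀ ring
  lem₂ : ∀ d e x s → d * (x * x) + e * x * s ≡ d * (x * (x * 1ℚ)) + e * s * x
  lem₂ = solve-∀ ring
  inner : ∀ j → sum (λ k → (𝟙 (does (k ≟ j)) * d + e) * (w j * w k)) ≡ d * w j ^ 2 + e * sum w * w j
  inner j = begin
    sum (λ k → (𝟙 (does (k ≟ j)) * d + e) * (w j * w k))
      ≡⟨ sum-cong-≗ (λ k → lem₁ (𝟙 (does (k ≟ j))) d e (w j) (w k)) ⟩
    sum (λ k → 𝟙 (does (k ≟ j)) * (d * (w j * w k)) + (e * w j) * w k)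
      ≡⟨ ∑-distrib-+ (λ k → 𝟙 (does (k ≟ j)) * (d * (w j * w k))) (λ k → (e * w j) * w k) ⟩
    sum (λ k → 𝟙 (does (k ≟ j)) * (d * (w j * w k))) + sum (λ k → (e * w j) * w k)
      ≡⟨ cong₂ _+_ (sum-δ j (λ k → d * (w j * w k))) (sum-*ˡ (e * w j) w) ⟩
    d * (w j * w j) + e * w j * sum w
      ≡⟨ lem₂ d e (w j) (sum w) ⟩
    d * w j ^ 2 + e * sum w * w j ∎

-- Witnesses non-emptiness of the sample space, so that `mean` really divides by its size.
∃∈permutations : ∀ n → ∃[ π ] π ∈ permutations n
∃∈permutations zero    = Perm.id , here refl
∃∈permutations (suc n) with ∃∈permutations n
... | π , π∈ = _ , ∈-cartesianProductWith⁺ (Perm.insert zero) (∈-allFin zero) π∈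

∃∈permutationSequences : ∀ n t → ∃[ v ] v ∈ permutationSequences n t
∃∈permutationSequences n zero    = [] , here refl
∃∈permutationSequences n (suc t) with ∃∈permutations n | ∃∈permutationSequences n t
... | π , π∈ | v , v∈ = _ , ∈-cartesianProductWith⁺ _∷_ π∈ v∈

-- The potential

sum-w₀ : ∀ {m} → 1 ℕ.≤ m → sum (w₀ {m}) ≡ 1ℚ
sum-w₀ {suc m} _ = trans (cong (_+_ 1ℚ) (trans (sum-*ˡ {m} 0ℚ (λ _ → 0ℚ)) (*-zeroˡ (sum {m} (λ _ → 0ℚ))))) (+-identityʳ 1ℚ)

Φ-w₀ : ∀ {m} → 1 ℕ.≤ m → Φ (w₀ {m}) ≡ 1ℚ - recip m
Φ-w₀ {suc m} _ = cong (_- recip (suc m)) (trans (cong (_+_ 1ℚ) (trans (sum-*ˡ {m} 0ℚ (λ _ → 0ℚ)) (*-zeroˡ (sum {m} (λ _ → 0ℚ))))) (+-identityʳ 1ℚ))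

sum-nonNeg : ∀ {n} (f : Fin n → ℚ) → (∀ i → 0ℚ ≤ f i) → 0ℚ ≤ sum f
sum-nonNeg {zero}  f 0≤f = ≤-refl
sum-nonNeg {suc n} f 0≤f = +-mono-≤ (0≤f zero) (sum-nonNeg (f ∘ suc) (0≤f ∘ suc))

∑-nonNeg : ∀ {A : Set} (xs : List A) f → (∀ x → 0ℚ ≤ f x) → 0ℚ ≤ ∑ xs f
∑-nonNeg []       f 0≤f = ≤-refl
∑-nonNeg (x ∷ xs) f 0≤f = +-mono-≤ (0≤f x) (∑-nonNeg xs f 0≤f)

square-nonNeg : ∀ x → 0ℚ ≤ x * x
square-nonNeg x with ≤-total 0ℚ x
... | inj₁ 0≤x = *-nonNeg 0≤x 0≤x
... | inj₂ x≤0 = nonNegative⁻¹ (x * x) {{nonPos*nonPos⇒nonPos x {{nonPositive x≤0}} x {{nonPositive x≤0}}}}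

fromℕ-recip′ : ∀ {m} → 1 ℕ.≤ m → fromℕ m * recip m ≡ 1ℚ
fromℕ-recip′ {suc m} _ = fromℕ-recip m

-- The cross term is fixed by the total weight 1, and the constant term by `m * recip m = 1`. The
-- variance form makes the potential nonnegative, from which `0 ≤ δ` follows.
Φ-variance : ∀ {m} → 1 ℕ.≤ m → (w : Weights m) → sum w ≡ 1ℚ →
  sum (λ i → (w i - recip m) * (w i - recip m)) ≡ Φ w
Φ-variance {m} 1≤m w Σw≡1 = begin
  sum (λ i → (w i - u) * (w i - u))
    ≡⟨ sum-cong-≗ (λ i → lem₁ (w i) u) ⟩
  sum (λ i → w i ^ 2 + ((- (u + u)) * w i + u * u * 1ℚ))
    ≡⟨ ∑-distrib-+ (λ i → w i ^ 2) (λ i → (- (u + u)) * w i + u * u * 1ℚ) ⟩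
  S + sum (λ i → (- (u + u)) * w i + u * u * 1ℚ)
    ≡⟨ cong (_+_ S) (∑-distrib-+ (λ i → (- (u + u)) * w i) (λ _ → u * u * 1ℚ)) ⟩
  S + (sum (λ i → (- (u + u)) * w i) + sum {m} (λ _ → u * u * 1ℚ))
    ≡⟨ cong (_+_ S) (cong₂ _+_ (trans (sum-*ˡ (- (u + u)) w) (cong ((- (u + u)) *_) Σw≡1))
         (trans (sum-*ˡ {m} (u * u) (λ _ → 1ℚ)) (trans (cong (u * u *_) (sum-1 m)) (lem₂ u (fromℕ m))))) ⟩
  S + ((- (u + u)) * 1ℚ + fromℕ m * u * u)
    ≡⟨ cong (λ z → S + ((- (u + u)) * 1ℚ + z * u)) (fromℕ-recip′ 1≤m) ⟩
  S + ((- (u + u)) * 1ℚ + 1ℚ * u)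
    ≡⟨ lem₃ S u ⟩
  S - u ∎
  where
  open ≡-Reasoning
  u = recip m
  S = sum (λ i → w i ^ 2)
  lem₁ : ∀ x u → (x - u) * (x - u) ≡ x * (x * 1ℚ) + ((- (u + u)) * x + u * u * 1ℚ)
  lem₁ = solve-∀ ring
  lem₂ : ∀ u k → u * u * k ≡ k * u * u
  lem₂ = solve-∀ ring
  lem₃ : ∀ s u → s + ((- (u + u)) * 1ℚ + 1ℚ * u) ≡ s - u
  lem₃ = solve-∀ ring

Φ-nonNeg : ∀ {m} → 1 ℕ.≤ m → (w : Weights m) → sum w ≡ 1ℚ → 0ℚ ≤ Φ w
Φ-nonNeg {m} 1≤m w Σw≡1 = subst (0ℚ ≤_) (Φ-variance 1≤m w Σw≡1)
  (sum-nonNeg (λ i → (w i - recip m) * (w i - recip m)) (λ i → square-nonNeg (w i - recip m)))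

-- Expected potential after one round and after t rounds

module Rounds (K M f : ℕ) (H : Subset M) (2≤m : 2 ℕ.≤ Mixnet.m K M f H) where

  open Mixnet K M f H
  open Averaging {m} {M} H

  1≤m : 1 ℕ.≤ m
  1≤m = ℕ.≤-trans (ℕ.s≤s ℕ.z≤n) 2≤m

  inj : Fin m → Fin n
  inj i = inject≤ i (ℕ.m∸n≤m n f)

  S : List (Permutation′ n)
  S = permutations n

  N r : ℚ
  N = ∑ S (λ _ → 1ℚ)
  r = recip (length S)

  N*r≡1 : N * r ≡ 1ℚ
  N*r≡1 with ∃∈permutations n
  ... | _ , π∈ = ∑-1*recip π∈

  server-cong : ∀ {π ρ} → π ≈ ρ → ∀ i → server π i ≡ server ρ i
  server-cong π≈ρ i = cong (quotient K) (π≈ρ (inj i))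

  totalGram : Fin m → Fin m → ℚ
  totalGram j k = ∑ S (λ π → gram (server π) j k)

  totalGram-invariant : ∀ x y j k →
    totalGram (transpose x y ⟨$⟩ʳ j) (transpose x y ⟨$⟩ʳ k) ≡ totalGram j k
  totalGram-invariant x y j k = begin
    ∑ S (λ π → gram (server π) (τ ⟨$⟩ʳ j) (τ ⟨$⟩ʳ k))
      ≡⟨ ∑-cong S (λ π → gram-equivariant {server π} {server (τ̂ ∘ₚ π)} τ (λ i → cong (λ p → quotient K (π ⟨$⟩ʳ p))
           (transpose-natural inj (inject≤-injective _ _ _ _) x y i)) j k) ⟨
    ∑ S (λ π → gram (server (τ̂ ∘ₚ π)) j k)
      ≡⟨ ∑-permutations-∘ₚ τ̂ (λ π → gram (server π) j k)
           -- Equivariance under the identity relabelling is the congruence for `≈` that the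
           -- re-indexing asks for.
           (λ {π} {ρ} π≈ρ → gram-equivariant {server ρ} {server π} Perm.id (server-cong {π} {ρ} π≈ρ) j k) ⟩
    ∑ S (λ π → gram (server π) j k) ∎
    where
    open ≡-Reasoning
    τ = transpose x y
    τ̂ = transpose (inj x) (inj y)

  -- Everything is kept as a sum over `S`, so `d` is `1 - γ` multiplied by the number `N` of
  -- permutations, and the equation determining `e` reads `N * u = d * u + e`. The point of the
  -- statement is that one `d` serves all `w`.
  contraction : ∃[ d ] (∀ w → sum w ≡ 1ℚ → ∑ S (λ π → Φ (step w π)) ≡ d * Φ w)
  contraction = from-entries (transpose-invariant 2≤m totalGram totalGram-invariant)
    where
    from-entries : ∃[ d ] ∃[ e ] (∀ j k → totalGram j k ≡ 𝟙 (does (k ≟ j)) * d + e) →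
      ∃[ d ] (∀ w → sum w ≡ 1ℚ → ∑ S (λ π → Φ (step w π)) ≡ d * Φ w)
    from-entries (d , e , eq) = d , decrease
      where
      open ≡-Reasoning
      u = recip m
      sq : Weights m → ℚ
      sq w = sum (λ i → w i ^ 2)
      total : ∀ w → sum w ≡ 1ℚ → ∑ S (λ π → sq (step w π)) ≡ d * sq w + e
      total w Σw≡1 = begin
        ∑ S (λ π → sq (step w π))
          ≡⟨ ∑-cong S (λ π → sum-avg-^2 (server π) w) ⟩
        ∑ S (λ π → sum (λ j → sum (λ k → gram (server π) j k * (w j * w k))))
          ≡⟨ ∑-comm-sum S (λ π j → sum (λ k → gram (server π) j k * (w j * w k))) ⟩
        sum (λ j → ∑ S (λ π → sum (λ k → gram (server π) j k * (w j * w k))))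
          ≡⟨ sum-cong-≗ (λ j → ∑-comm-sum S (λ π k → gram (server π) j k * (w j * w k))) ⟩
        sum (λ j → sum (λ k → ∑ S (λ π → gram (server π) j k * (w j * w k))))
          ≡⟨ sum-cong-≗ (λ j → sum-cong-≗ (λ k → trans
               (∑-*ʳ S (w j * w k) (λ π → gram (server π) j k)) (cong (_* (w j * w k)) (eq j k)))) ⟩
        sum (λ j → sum (λ k → (𝟙 (does (k ≟ j)) * d + e) * (w j * w k)))
          ≡⟨ quadratic-form d e w ⟩
        d * sq w + e * (sum w * sum w)
          ≡⟨ cong (λ z → d * sq w + e * (z * z)) Σw≡1 ⟩
        d * sq w + e * 1ℚ
          ≡⟨ cong (_+_ (d * sq w)) (*-identityʳ e) ⟩
        d * sq w + e ∎
      uniform : Weights m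
      uniform _ = u
      sum-uniform : sum uniform ≡ 1ℚ
      sum-uniform = begin
        sum uniform                 ≡⟨ sum-cong-≗ {m} (λ _ → *-identityʳ u) ⟨
        sum {m} (λ _ → u * 1ℚ)      ≡⟨ sum-*ˡ {m} u (λ _ → 1ℚ) ⟩
        u * sum {m} (λ _ → 1ℚ)      ≡⟨ cong (u *_) (sum-1 m) ⟩
        u * fromℕ m                 ≡⟨ *-comm u (fromℕ m) ⟩
        fromℕ m * u                 ≡⟨ fromℕ-recip′ 1≤m ⟩
        1ℚ                          ∎
      sq-uniform : sq uniform ≡ u
      sq-uniform = begin
        sq uniform               ≡⟨ sum-*ˡ {m} u (λ _ → u * 1ℚ) ⟩
        u * sum {m} (λ _ → u * 1ℚ)   ≡⟨ cong (u *_) (trans (sum-cong-≗ {m} (λ _ → *-identityʳ u)) sum-uniform) ⟩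
        u * 1ℚ                   ≡⟨ *-identityʳ u ⟩
        u                        ∎
      N*u≡ : N * u ≡ d * u + e
      N*u≡ = begin
        N * u                              ≡⟨ ∑-*ʳ S u (λ _ → 1ℚ) ⟨
        ∑ S (λ _ → 1ℚ * u)                 ≡⟨ ∑-cong S (λ π → trans (*-identityˡ u) (trans (sym sq-uniform)
                                                (sum-cong-≗ (λ i → cong (_^ 2) (sym (avg-const (server π) u i)))))) ⟩
        ∑ S (λ π → sq (step uniform π))    ≡⟨ total uniform sum-uniform ⟩
        d * sq uniform + e                 ≡⟨ cong (λ z → d * z + e) sq-uniform ⟩
        d * u + e                          ∎
      lem : ∀ d s e u x → d * s + e + (- 1ℚ) * x ≡ d * (s - u) + ((d * u + e) - x)
      lem = solve-∀ ring
      lem′ : ∀ x y → x + (y - y) ≡ x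
      lem′ = solve-∀ ring
      neg1 : ∀ x → - x ≡ (- 1ℚ) * (1ℚ * x)
      neg1 = solve-∀ ring
      decrease : ∀ w → sum w ≡ 1ℚ → ∑ S (λ π → Φ (step w π)) ≡ d * Φ w
      decrease w Σw≡1 = begin
        ∑ S (λ π → sq (step w π) - u)
          ≡⟨ ∑-+ S (λ π → sq (step w π)) (λ _ → - u) ⟩
        ∑ S (λ π → sq (step w π)) + ∑ S (λ _ → - u)
          ≡⟨ cong₂ _+_ (total w Σw≡1) (trans (∑-cong S (λ _ → neg1 u))
               (trans (∑-*ˡ S (- 1ℚ) (λ _ → 1ℚ * u)) (cong ((- 1ℚ) *_) (∑-*ʳ S u (λ _ → 1ℚ))))) ⟩
        d * sq w + e + (- 1ℚ) * (N * u)
          ≡⟨ lem d (sq w) e u (N * u) ⟩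
        d * (sq w - u) + ((d * u + e) - N * u)
          ≡⟨ cong (λ z → d * (sq w - u) + (z - N * u)) N*u≡ ⟨
        d * (sq w - u) + (N * u - N * u)
          ≡⟨ lem′ (d * (sq w - u)) (N * u) ⟩
        d * (sq w - u) ∎

  sum-step : ∀ w π → sum (step w π) ≡ sum w
  sum-step w π = sum-avg (server π) w

  module Contraction (d : ℚ) (decrease : ∀ w → sum w ≡ 1ℚ → ∑ S (λ π → Φ (step w π)) ≡ d * Φ w) where

    δ : ℚ
    δ = d * r

    d≡δ*N : d ≡ δ * N
    d≡δ*N = begin
      d            ≡⟨ *-identityʳ d ⟨
      d * 1ℚ       ≡⟨ cong (d *_) N*r≡1 ⟨
      d * (N * r)  ≡⟨ lem d N r ⟩
      d * r * N    ∎
      where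
      open ≡-Reasoning
      lem : ∀ d N r → d * (N * r) ≡ d * r * N
      lem = solve-∀ ring

    numSeq : ℕ → ℚ
    numSeq t = ∑ (permutationSequences n t) (λ _ → 1ℚ)

    numSeq-suc : ∀ t → numSeq (suc t) ≡ N * numSeq t
    numSeq-suc t = trans (∑-cartesianProductWith _∷_ S (permutationSequences n t) (λ _ → 1ℚ))
      (trans (∑-cong S (λ _ → sym (*-identityˡ (numSeq t)))) (∑-*ʳ S (numSeq t) (λ _ → 1ℚ)))

    -- The left fold spends the first permutation on the starting weights, so the induction must
    -- allow any start of total weight 1; the hypothesis is then used at `step w π`.
    totalΦ : ∀ t w → sum w ≡ 1ℚ →
      ∑ (permutationSequences n t) (λ πs → Φ (Vec.foldl′ step w πs)) ≡ δ ^ t * numSeq t * Φ w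
    totalΦ zero    w Σw≡1 = lem (Φ w)
      where
      lem : ∀ x → x + 0ℚ ≡ 1ℚ * (1ℚ + 0ℚ) * x
      lem = solve-∀ ring
    totalΦ (suc t) w Σw≡1 = begin
      ∑ (permutationSequences n (suc t)) (λ πs → Φ (Vec.foldl′ step w πs))
        ≡⟨ ∑-cartesianProductWith _∷_ S (permutationSequences n t) (λ πs → Φ (Vec.foldl′ step w πs)) ⟩
      ∑ S (λ π → ∑ (permutationSequences n t) (λ πs → Φ (Vec.foldl′ step (step w π) πs)))
        ≡⟨ ∑-cong S (λ π → totalΦ t (step w π) (trans (sum-step w π) Σw≡1)) ⟩
      ∑ S (λ π → δ ^ t * numSeq t * Φ (step w π))
        ≡⟨ ∑-*ˡ S (δ ^ t * numSeq t) (λ π → Φ (step w π)) ⟩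
      δ ^ t * numSeq t * ∑ S (λ π → Φ (step w π))
        ≡⟨ cong (δ ^ t * numSeq t *_) (trans (decrease w Σw≡1) (cong (_* Φ w) d≡δ*N)) ⟩
      δ ^ t * numSeq t * (δ * N * Φ w)
        ≡⟨ lem (δ ^ t) (numSeq t) δ N (Φ w) ⟩
      δ * δ ^ t * (N * numSeq t) * Φ w
        ≡⟨ cong (λ z → δ * δ ^ t * z * Φ w) (numSeq-suc t) ⟨
      δ ^ suc t * numSeq (suc t) * Φ w ∎
      where
      open ≡-Reasoning
      lem : ∀ p l δ N x → p * l * (δ * N * x) ≡ δ * p * (N * l) * x
      lem = solve-∀ ring

    𝔼Φ-formula : ∀ t → 𝔼Φ t ≡ δ ^ t * (1ℚ - recip m)
    𝔼Φ-formula t with ∃∈permutationSequences n t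
    ... | _ , v∈ = begin
      𝔼Φ t
        ≡⟨ mean-map (permutationSequences n t) (λ πs → Φ (weightsAfter πs)) ⟩
      ∑ (permutationSequences n t) (λ πs → Φ (weightsAfter πs)) * R
        ≡⟨ cong (_* R) (totalΦ t w₀ (sum-w₀ 1≤m)) ⟩
      δ ^ t * numSeq t * Φ (w₀ {m}) * R
        ≡⟨ lem (δ ^ t) (numSeq t) (Φ (w₀ {m})) R ⟩
      δ ^ t * Φ (w₀ {m}) * (numSeq t * R)
        ≡⟨ cong₂ (λ x y → δ ^ t * x * y) (Φ-w₀ 1≤m) (∑-1*recip v∈) ⟩
      δ ^ t * (1ℚ - recip m) * 1ℚ
        ≡⟨ *-identityʳ _ ⟩
      δ ^ t * (1ℚ - recip m) ∎
      where
      open ≡-Reasoning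
      R = recip (length (permutationSequences n t))
      lem : ∀ p l x R → p * l * x * R ≡ p * x * (l * R)
      lem = solve-∀ ring

    expectedRelativeDecrease-formula : ∀ w → sum w ≡ 1ℚ → .{{_ : Positive (Φ w)}} →
      1ℚ - expectedRelativeDecrease w ≡ δ
    expectedRelativeDecrease-formula w Σw≡1 = begin
      1ℚ - expectedRelativeDecrease w
        ≡⟨ cong (_-_ 1ℚ) (mean-map S (λ π → (Φ w - Φ (step w π)) * v)) ⟩
      1ℚ - ∑ S (λ π → (Φ w - Φ (step w π)) * v) * r
        ≡⟨ cong (λ z → 1ℚ - z * r) (trans (∑-*ʳ S v (λ π → Φ w - Φ (step w π))) (cong (_* v) total)) ⟩
      1ℚ - (N * Φ w + (- 1ℚ) * (d * Φ w)) * v * r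
        ≡⟨ lem₂ N (Φ w) d v r ⟩
      1ℚ - (N * r) * (Φ w * v) + (d * r) * (Φ w * v)
        ≡⟨ cong₂ (λ x y → 1ℚ - x * y + (d * r) * y) N*r≡1 (*-inverseʳ (Φ w)) ⟩
      1ℚ - 1ℚ * 1ℚ + (d * r) * 1ℚ
        ≡⟨ lem₃ (d * r) ⟩
      δ ∎
      where
      open ≡-Reasoning
      instance
        _ = pos⇒nonZero (Φ w)
      v = 1/ Φ w
      lem₁ : ∀ x y → x - y ≡ 1ℚ * x + (- 1ℚ) * y
      lem₁ = solve-∀ ring
      lem₂ : ∀ N x d v r → 1ℚ - (N * x + (- 1ℚ) * (d * x)) * v * r ≡ 1ℚ - (N * r) * (x * v) + (d * r) * (x * v)
      lem₂ = solve-∀ ring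
      lem₃ : ∀ x → 1ℚ - 1ℚ * 1ℚ + x * 1ℚ ≡ x
      lem₃ = solve-∀ ring
      total : ∑ S (λ π → Φ w - Φ (step w π)) ≡ N * Φ w + (- 1ℚ) * (d * Φ w)
      total = begin
        ∑ S (λ π → Φ w - Φ (step w π))
          ≡⟨ ∑-cong S (λ π → lem₁ (Φ w) (Φ (step w π))) ⟩
        ∑ S (λ π → 1ℚ * Φ w + (- 1ℚ) * Φ (step w π))
          ≡⟨ ∑-+ S (λ π → 1ℚ * Φ w) (λ π → (- 1ℚ) * Φ (step w π)) ⟩
        ∑ S (λ π → 1ℚ * Φ w) + ∑ S (λ π → (- 1ℚ) * Φ (step w π))
          ≡⟨ cong₂ _+_ (∑-*ʳ S (Φ w) (λ _ → 1ℚ))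
               (trans (∑-*ˡ S (- 1ℚ) (λ π → Φ (step w π))) (cong ((- 1ℚ) *_) (decrease w Σw≡1))) ⟩
        N * Φ w + (- 1ℚ) * (d * Φ w) ∎

    -- `δ * Φ w` is the mean of the potentials after one round, none of which is negative; the
    -- positive factor `Φ w` cancels.
    δ-nonNeg : ∀ w → sum w ≡ 1ℚ → .{{_ : Positive (Φ w)}} → 0ℚ ≤ δ
    δ-nonNeg w Σw≡1 = *-cancelʳ-≤-pos (Φ w) (begin
      0ℚ * Φ w                               ≡⟨ *-zeroˡ (Φ w) ⟩
      0ℚ                                     ≤⟨ *-nonNeg (∑-nonNeg S (λ π → Φ (step w π)) (λ π →
                                                  Φ-nonNeg 1≤m (step w π) (trans (sum-step w π) Σw≡1)))
                                                  (recip-nonNeg (length S)) ⟩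
      ∑ S (λ π → Φ (step w π)) * r           ≡⟨ cong (_* r) (decrease w Σw≡1) ⟩
      d * Φ w * r                            ≡⟨ lem d (Φ w) r ⟩
      δ * Φ w                                ∎)
      where
      open ≤-Reasoning
      lem : ∀ d x r → d * x * r ≡ d * r * x
      lem = solve-∀ ring
      recip-nonNeg : ∀ k → 0ℚ ≤ recip k
      recip-nonNeg zero    = ≤-refl
      recip-nonNeg (suc k) = nonNegative⁻¹ (recip (suc k)) {{normalize-nonNeg 1 (suc k)}}

  -- `γ` is measured at an arbitrary `w`, while the process starts at `w₀`. The common `d` of
  -- `contraction` links the two.
  𝔼Φ-geometric : ∀ w → sum w ≡ 1ℚ → .{{_ : Positive (Φ w)}} →
    let δ = 1ℚ - expectedRelativeDecrease w in
    0ℚ ≤ δ × (∀ t → 𝔼Φ t ≡ δ ^ t * (1ℚ - recip m))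
  𝔼Φ-geometric w Σw≡1 = finish contraction
    where
    finish : ∃[ d ] (∀ w → sum w ≡ 1ℚ → ∑ S (λ π → Φ (step w π)) ≡ d * Φ w) →
      0ℚ ≤ 1ℚ - expectedRelativeDecrease w
        × (∀ t → 𝔼Φ t ≡ (1ℚ - expectedRelativeDecrease w) ^ t * (1ℚ - recip m))
    finish (d , decrease) =
        subst (0ℚ ≤_) (sym γ≡) (C.δ-nonNeg w Σw≡1)
      , λ t → trans (C.𝔼Φ-formula t) (cong (λ z → z ^ t * (1ℚ - recip m)) (sym γ≡))
      where
      module C = Contraction d decrease
      γ≡ = C.expectedRelativeDecrease-formula w Σw≡1

-- Cuts

-- i / (d + 1) need not be in lowest terms.
IsFraction : ℚ → ℤ.ℤ → ℕ → Set
IsFraction p i d = toℚᵘ p ℚᵘ.≃ ℚᵘ.mkℚᵘ i d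

/-isFraction : ∀ i d → IsFraction (i / suc d) i d
/-isFraction i d = toℚᵘ-fromℚᵘ (ℚᵘ.mkℚᵘ i d)

neg-isFraction : ∀ {p a d} → IsFraction p (ℤ.+ suc a) d → IsFraction (- p) -[1+ a ] d
neg-isFraction {p} {a} {d} eq = ℚᵘ.≃-trans (toℚᵘ-homo‿- p) (ℚᵘ.-‿cong eq)

fraction-* : ∀ {p a d} → IsFraction p (ℤ.+ a) d → p * fromℕ (suc d) ≡ fromℕ a
fraction-* {p} {a} {d} eq = toℚᵘ-injective (begin
  toℚᵘ (p * fromℕ (suc d))                              ≈⟨ toℚᵘ-homo-* p (fromℕ (suc d)) ⟩
  toℚᵘ p ℚᵘ.* toℚᵘ (fromℕ (suc d))                      ≈⟨ ℚᵘ.*-cong eq (toℚᵘ-fromℕ (suc d)) ⟩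
  ℚᵘ.mkℚᵘ (ℤ.+ a) d ℚᵘ.* ℚᵘ.mkℚᵘ (ℤ.+ suc d) 0          ≈⟨ ℚᵘ.*≡* (trans (ℤ.*-identityʳ (ℤ.+ a ℤ.* ℤ.+ suc d))
                                                             (cong (λ z → ℤ.+ a ℤ.* ℤ.+ z) (sym (ℕ.*-identityʳ (suc d))))) ⟩
  ℚᵘ.mkℚᵘ (ℤ.+ a) 0                                     ≈⟨ toℚᵘ-fromℕ a ⟨
  toℚᵘ (fromℕ a)                                        ∎)
  where open ℚᵘ.≃-Reasoning

fraction-pos : ∀ {p a d} → IsFraction p (ℤ.+ suc a) d → 0ℚ < p
fraction-pos {p} {a} {d} eq = *-cancelʳ-<-nonNeg (fromℕ (suc d)) {{fromℕ-nonNeg (suc d)}}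
  (subst₂ _<_ (sym (*-zeroˡ (fromℕ (suc d)))) (sym (fraction-* {p} {suc a} {d} eq))
    (positive⁻¹ (fromℕ (suc a)) {{fromℕ-pos a}}))

fraction-inverse : ∀ {p q a d} → IsFraction p (ℤ.+ suc a) d → IsFraction q (ℤ.+ suc d) a → q * p ≡ 1ℚ
fraction-inverse {p} {q} {a} {d} p≃ q≃ = begin
  q * p                                                   ≡⟨ *-identityʳ (q * p) ⟨
  q * p * 1ℚ                                              ≡⟨ cong (q * p *_) (fromℕ-recip d) ⟨
  q * p * (fromℕ (suc d) * recip (suc d))                 ≡⟨ lem₁ q p (fromℕ (suc d)) (recip (suc d)) ⟩
  q * (p * fromℕ (suc d)) * recip (suc d)                 ≡⟨ cong (λ z → q * z * recip (suc d)) (fraction-* {p} p≃) ⟩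
  q * fromℕ (suc a) * recip (suc d)                       ≡⟨ cong (_* recip (suc d)) (fraction-* {q} q≃) ⟩
  fromℕ (suc d) * recip (suc d)                           ≡⟨ fromℕ-recip d ⟩
  1ℚ                                                      ∎
  where
  open ≡-Reasoning
  lem₁ : ∀ q p x y → q * p * (x * y) ≡ q * (p * x) * y
  lem₁ = solve-∀ ring

-- Here `q` is `t / p`, written as a fraction of naturals. It is the exponent against which the
-- logarithm and `c` are later tested.
fraction-scale : ∀ {p q j k} t → IsFraction p (ℤ.+ suc j) k → IsFraction q (ℤ.+ (t ℕ.* suc k)) j →
  p * q ≡ fromℕ t
fraction-scale {p} {q} {j} {k} t p≃ q≃ = begin
  p * q                                                         ≡⟨ *-identityʳ (p * q) ⟨
  p * q * 1ℚ                                                    ≡⟨ cong (p * q *_) (fromℕ-recip j) ⟨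
  p * q * (fromℕ (suc j) * recip (suc j))                       ≡⟨ lem₁ p q (fromℕ (suc j)) (recip (suc j)) ⟩
  p * (q * fromℕ (suc j)) * recip (suc j)                       ≡⟨ cong (λ z → p * z * recip (suc j)) (trans (fraction-* {q} q≃) (fromℕ-* t (suc k))) ⟩
  p * (fromℕ t * fromℕ (suc k)) * recip (suc j)                 ≡⟨ lem₂ p (fromℕ t) (fromℕ (suc k)) (recip (suc j)) ⟩
  fromℕ t * ((p * fromℕ (suc k)) * recip (suc j))               ≡⟨ cong (λ z → fromℕ t * (z * recip (suc j))) (fraction-* {p} p≃) ⟩
  fromℕ t * (fromℕ (suc j) * recip (suc j))                     ≡⟨ cong (fromℕ t *_) (fromℕ-recip j) ⟩
  fromℕ t * 1ℚ                                                  ≡⟨ *-identityʳ (fromℕ t) ⟩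
  fromℕ t                                                       ∎
  where
  open ≡-Reasoning
  lem₁ : ∀ q p x y → q * p * (x * y) ≡ q * (p * x) * y
  lem₁ = solve-∀ ring
  lem₂ : ∀ p t x y → p * (t * x) * y ≡ t * ((p * x) * y)
  lem₂ = solve-∀ ring

-- `Pow<` inspects the reduced form of `p`, whereas computed exponents come unreduced. Raising each
-- comparison to the other denominator makes the exponents agree by cross-multiplication; the common
-- power is then cancelled.
Pow<-fraction : ∀ {β x a d} p → IsFraction p (ℤ.+ a) d → 0ℚ < x → β ^ a < x ^ suc d → 0ℚ < β → Pow< β p x
Pow<-fraction {β} {x} {a} {d} (mkℚ (ℤ.+ a′) d′ _) (ℚᵘ.*≡* eq) 0<x lt 0<β =
  0<x , ^-cancel-< (suc d) (^-nonNeg (suc d′) (<⇒≤ 0<x)) (begin-strict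
    (β ^ a′) ^ suc d       ≡⟨ ^-assocʳ β a′ (suc d) ⟩
    β ^ (a′ ℕ.* suc d)     ≡⟨ cong (β ^_) (ℤ.+-injective (trans (ℤ.pos-* a′ (suc d)) (trans eq (sym (ℤ.pos-* a (suc d′)))))) ⟩
    β ^ (a ℕ.* suc d′)     ≡⟨ ^-assocʳ β a (suc d′) ⟨
    (β ^ a) ^ suc d′       <⟨ ^-mono-< d′ (^-nonNeg a (<⇒≤ 0<β)) lt ⟩
    (x ^ suc d) ^ suc d′   ≡⟨ ^-^-comm x (suc d) (suc d′) ⟩
    (x ^ suc d′) ^ suc d   ∎)
  where open ≤-Reasoning
Pow<-fraction {a = a} (mkℚ -[1+ a′ ] d′ _) (ℚᵘ.*≡* eq) _ _ _ with trans eq (sym (ℤ.pos-* a (suc d′)))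
... | ()

Pow<-neg-fraction : ∀ {β x a d} p → IsFraction p -[1+ a ] d → 0ℚ < x →
  1ℚ < x ^ suc d * β ^ suc a → 0ℚ < β → Pow< β p x
Pow<-neg-fraction {d = d} (mkℚ (ℤ.+ a′) d′ _) (ℚᵘ.*≡* eq) _ _ _ with trans (ℤ.pos-* a′ (suc d)) eq
... | ()
Pow<-neg-fraction {β} {x} {a} {d} (mkℚ -[1+ a′ ] d′ _) (ℚᵘ.*≡* eq) 0<x lt 0<β =
  0<x , ^-cancel-< (suc d) (*-nonNeg (^-nonNeg (suc d′) (<⇒≤ 0<x)) (^-nonNeg (suc a′) (<⇒≤ 0<β))) (begin-strict
    1ℚ ^ suc d                                        ≡⟨ 1^n≡1 (suc d) ⟩
    1ℚ                                                <⟨ 1<^ d′ lt ⟩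
    (x ^ suc d * β ^ suc a) ^ suc d′                  ≡⟨ ^-distrib-* (x ^ suc d) (β ^ suc a) (suc d′) ⟩
    (x ^ suc d) ^ suc d′ * (β ^ suc a) ^ suc d′       ≡⟨ cong₂ _*_ (^-^-comm x (suc d) (suc d′)) exponents ⟩
    (x ^ suc d′) ^ suc d * (β ^ suc a′) ^ suc d       ≡⟨ ^-distrib-* (x ^ suc d′) (β ^ suc a′) (suc d) ⟨
    (x ^ suc d′ * β ^ suc a′) ^ suc d                 ∎)
  where
  open ≤-Reasoning
  exponents : (β ^ suc a) ^ suc d′ ≡ (β ^ suc a′) ^ suc d
  exponents = trans (^-assocʳ β (suc a) (suc d′)) (trans
    (cong (β ^_) (sym (cong suc (ℤ.-[1+-injective eq))))
    (sym (^-assocʳ β (suc a′) (suc d))))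

-- Provides the order of the two endpoints when the logarithm enters an interval product. Both
-- bounds on `x` are raised to a common denominator, leaving two powers of `β` to compare; a
-- negative `q` is impossible because `x` and `β` exceed 1.
log-separated : ∀ {β x p q} → 1ℚ < β → 1ℚ < x → 0ℚ ≤ p → Pow< β p x → <Pow x β q → p < q
log-separated {β} {x} {mkℚ -[1+ _ ] _ _} {q} 1<β 1<x (*≤* ()) _ _
log-separated {p = mkℚ (ℤ.+ _) _ _} {mkℚ (ℤ.+ _) _ _} _ _ _ (0<x , _) (inj₁ x≤0) = ⊥-elim (<-irrefl refl (<-≤-trans 0<x x≤0))
log-separated {p = mkℚ (ℤ.+ _) _ _} {mkℚ -[1+ _ ] _ _} _ _ _ (0<x , _) (inj₁ x≤0) = ⊥-elim (<-irrefl refl (<-≤-trans 0<x x≤0))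
log-separated {β} {x} {mkℚ (ℤ.+ a) k _} {mkℚ -[1+ a′ ] k′ _} 1<β 1<x _ (0<x , lt) (inj₂ lt′) =
  ⊥-elim (<-asym lt′ (<-≤-trans (1<^ k′ 1<x) (subst (_≤ x ^ suc k′ * β ^ suc a′) (*-identityʳ (x ^ suc k′))
    (*-monoˡ-≤-nonNeg (x ^ suc k′) {{nonNegative (^-nonNeg (suc k′) (<⇒≤ 0<x))}} (1≤^ (suc a′) (<⇒≤ 1<β))))))
log-separated {β} {x} {p@(mkℚ (ℤ.+ a) k _)} {q@(mkℚ (ℤ.+ a′) k′ _)} 1<β 1<x _ (0<x , lt) (inj₂ lt′) =
  ≰⇒> (λ q≤p → <-irrefl refl (<-≤-trans strict (monotone (numerators q≤p))))
  where
  0≤β = <⇒≤ (<-trans 0<1 1<β)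
  strict : β ^ (a ℕ.* suc k′) < β ^ (a′ ℕ.* suc k)
  strict = begin-strict
    β ^ (a ℕ.* suc k′)      ≡⟨ ^-assocʳ β a (suc k′) ⟨
    (β ^ a) ^ suc k′        <⟨ ^-mono-< k′ (^-nonNeg a 0≤β) lt ⟩
    (x ^ suc k) ^ suc k′    ≡⟨ ^-^-comm x (suc k) (suc k′) ⟩
    (x ^ suc k′) ^ suc k    <⟨ ^-mono-< k (^-nonNeg (suc k′) (<⇒≤ 0<x)) lt′ ⟩
    (β ^ a′) ^ suc k        ≡⟨ ^-assocʳ β a′ (suc k) ⟩
    β ^ (a′ ℕ.* suc k)      ∎
    where open ≤-Reasoning
  numerators : q ≤ p → a′ ℕ.* suc k ℕ.≤ a ℕ.* suc k′
  numerators (*≤* le) = ℤ.drop‿+≤+ (subst₂ ℤ._≤_ (sym (ℤ.pos-* a′ (suc k))) (sym (ℤ.pos-* a (suc k′))) le)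
  monotone : ∀ {i j} → i ℕ.≤ j → β ^ i ≤ β ^ j
  monotone {i} {j} i≤j = begin
    β ^ i                     ≡⟨ *-identityʳ (β ^ i) ⟨
    β ^ i * 1ℚ                ≤⟨ *-monoˡ-≤-nonNeg (β ^ i) {{nonNegative (^-nonNeg i 0≤β)}} (1≤^ (j ℕ.∸ i) (<⇒≤ 1<β)) ⟩
    β ^ i * β ^ (j ℕ.∸ i)     ≡⟨ ^-homo-* β i (j ℕ.∸ i) ⟨
    β ^ (i ℕ.+ (j ℕ.∸ i))     ≡⟨ cong (β ^_) (ℕ.m+[n∸m]≡n i≤j) ⟩
    β ^ j                     ∎
    where open ≤-Reasoning

-- Explicit rational bounds for products, reciprocal powers and logarithms

<-⊓ : ∀ {p q s} → s < p → s < q → s < p ⊓ q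
<-⊓ {p} {q} {s} s<p s<q = [ (λ eq → subst (s <_) (sym eq) s<p) , (λ eq → subst (s <_) (sym eq) s<q) ]′ (⊓-sel p q)

-- With positive lower endpoints the least of the four corner products is `a * c`. The dense `q` is
-- needed because `<ᴿ` wants strict room on both sides.
*ᴿ-lower : ∀ {x y s a a′ c c′} → 0ℚ < a → 0ℚ < c → L x a → U x a′ → a ≤ a′ → L y c → U y c′ → c ≤ c′ →
  s < a * c → ι s <ᴿ x *ᴿ y
*ᴿ-lower {s = s} {a} {a′} {c} {c′} 0<a 0<c La Ua′ a≤a′ Lc Uc′ c≤c′ s<ac with <-dense s<ac
... | q , s<q , q<ac = q , s<q , a , a′ , c , c′ , La , Ua′ , Lc , Uc′ ,
  <-⊓ (<-⊓ q<ac (below ≤-refl c≤c′)) (<-⊓ (below a≤a′ ≤-refl) (below a≤a′ c≤c′))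
  where
  below : ∀ {a₁ c₁} → a ≤ a₁ → c ≤ c₁ → q < a₁ * c₁
  below a≤ c≤ = <-≤-trans q<ac (*-mono-≤-nonNeg (<⇒≤ 0<a) (≤-trans (<⇒≤ 0<c) c≤) a≤ c≤)

½-isFraction : IsFraction ½ (ℤ.+ 1) 1
½-isFraction = /-isFraction (ℤ.+ 1) 1

½<1 : ½ < 1ℚ
½<1 = *-cancelʳ-<-nonNeg (fromℕ 2) {{fromℕ-nonNeg 2}} (subst₂ _<_
  (sym (fraction-* {½} {1} {1} ½-isFraction)) (sym (*-identityˡ (fromℕ 2)))
  1<2)

-- Supplies a positive lower bound. If instead 1 were an upper bound, roundedness would give an
-- upper bound strictly below 1, against `1 ≤ x`.
½-lower : ∀ {x} → IsReal x → ι 1ℚ ≤ᴿ x → L x ½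
½-lower {x} real 1≤x = by-location (IsReal.located real ½<1)
  where
  by-location : L x ½ ⊎ U x 1ℚ → L x ½
  by-location (inj₁ L½) = L½
  by-location (inj₂ U1) = ⊥-elim (below-1 (Equivalence.to (IsReal.U-rounded real 1ℚ) U1))
    where
    below-1 : ∃[ r ] (r < 1ℚ × U x r) → ⊥
    below-1 (r , r<1 , Ur) = 1≤x (r , Ur , r<1)

-- The exponent below b that comes with q need not be positive; if it is not, then
-- r < 1 and ½ serves instead.
1/^ᴿ-upper : ∀ {x b q} → 1ℚ < x → IsReal b → ι 1ℚ ≤ᴿ b → U (1/ᴿ (x ^ᴿ b)) q →
  ∃[ r ] ∃[ ρ ] ∃[ j ] ∃[ k ]
    (0ℚ < r × 1ℚ < q * r × L b ρ × IsFraction ρ (ℤ.+ suc j) k × r ^ suc k < x ^ suc j)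
1/^ᴿ-upper {x} {b} {q} 1<x real 1≤b (r , 0<r , (ρ , Lρ , pow) , 1<qr) = by-sign ρ Lρ pow
  where
  Goal : Set
  Goal = ∃[ r ] ∃[ ρ ] ∃[ j ] ∃[ k ]
    (0ℚ < r × 1ℚ < q * r × L b ρ × IsFraction ρ (ℤ.+ suc j) k × r ^ suc k < x ^ suc j)
  r^2<x : r < 1ℚ → r ^ 2 < x ^ 1
  r^2<x r<1 = begin-strict
    r ^ 2    <⟨ ^-mono-< {r} {1ℚ} 1 (<⇒≤ 0<r) r<1 ⟩
    1ℚ ^ 2   ≡⟨ 1^n≡1 2 ⟩
    1ℚ       <⟨ 1<^ {x} 0 1<x ⟩
    x ^ 1    ∎
    where open ≤-Reasoning
  small : ∀ h → IsFraction h (ℤ.+ 1) 1 → L b h → r < 1ℚ → Goal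
  small h h≃ Lh r<1 = r , h , 0 , 1 , 0<r , 1<qr , Lh , h≃ , r^2<x r<1
  small-½ : r < 1ℚ → Goal
  small-½ = small ½ ½-isFraction (½-lower real 1≤b)
  r^[k+1]<1⇒r<1 : ∀ k → r ^ suc k < 1ℚ → r < 1ℚ
  r^[k+1]<1⇒r<1 k lt = ^-cancel-< (suc k) (<⇒≤ 0<1) (subst (r ^ suc k <_) (sym (1^n≡1 (suc k))) lt)
  by-sign : ∀ ρ → L b ρ → <Pow r x ρ → Goal
  by-sign (mkℚ (ℤ.+ _) _ _) _ (inj₁ r≤0) = ⊥-elim (<-irrefl refl (<-≤-trans 0<r r≤0))
  by-sign (mkℚ -[1+ _ ] _ _) _ (inj₁ r≤0) = ⊥-elim (<-irrefl refl (<-≤-trans 0<r r≤0))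
  by-sign ρ@(mkℚ (ℤ.+ suc j) k _) Lρ (inj₂ lt) = r , ρ , j , k , 0<r , 1<qr , Lρ , ℚᵘ.≃-refl , lt
  by-sign (mkℚ (ℤ.+ zero) k _) _ (inj₂ lt) = small-½ (r^[k+1]<1⇒r<1 k lt)
  by-sign (mkℚ -[1+ j ] k _) _ (inj₂ lt) = small-½ (r^[k+1]<1⇒r<1 k
    (≤-<-trans (subst (_≤ r ^ suc k * x ^ suc j) (*-identityʳ (r ^ suc k))
      (*-monoˡ-≤-nonNeg (r ^ suc k) {{nonNegative (^-nonNeg (suc k) (<⇒≤ 0<r))}} (1≤^ (suc j) (<⇒≤ 1<x)))) lt))

-- For `k ≥ β` the exponent `1 / (k + 1)` works, since `k + 1 < x ^ (k + 1)`. It covers `t = 0`,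
-- where `t / ρ` is not a positive lower bound.
log-lower-positive : ∀ {β x} → fromℕ 2 ≤ x → 0ℚ < β → ∃[ p ] (0ℚ < p × L (log β x) p)
log-lower-positive {β} {x} 2≤x 0<β with archimedean β
... | k , β≤k = ℤ.+ 1 / suc k , fraction-pos {ℤ.+ 1 / suc k} {0} {k} (/-isFraction (ℤ.+ 1) k) ,
  Pow<-fraction (ℤ.+ 1 / suc k) (/-isFraction (ℤ.+ 1) k) (<-≤-trans (positive⁻¹ (fromℕ 2)) 2≤x) (begin-strict
    β ^ 1           ≡⟨ *-identityʳ β ⟩
    β               ≤⟨ β≤k ⟩
    fromℕ k         ≤⟨ fromℕ-mono-≤ (ℕ.n≤1+n k) ⟩
    fromℕ (suc k)   <⟨ n<x^n (suc k) 2≤x ⟩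
    x ^ suc k       ∎) 0<β
  where open ≤-Reasoning

0<[q*r]⇒0<q : ∀ {q r} → 0ℚ < r → 1ℚ < q * r → 0ℚ < q
0<[q*r]⇒0<q {q} {r} 0<r 1<qr = *-cancelʳ-<-nonNeg r {{nonNegative (<⇒≤ 0<r)}}
  (subst (_< q * r) (sym (*-zeroˡ r)) (<-trans {0ℚ} {1ℚ} {q * r} 0<1 1<qr))

-- From geometric decay to bounds by real powers

decay-by-log : ∀ {β x b E} t → fromℕ 2 ≤ x → 1ℚ < β → IsReal b → ι 1ℚ ≤ᴿ b →
  t ≡⌈ b *ᴿ log β x ⌉ → β ^ t * E ≤ 1ℚ → ι E ≤ᴿ 1/ᴿ (x ^ᴿ b)
decay-by-log {β} {x} {b} {E} t 2≤x 1<β real 1≤b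
  -- The upper endpoints `a′` of `b` and `c′` of the logarithm are read off the witness that `t - 1`
  -- lies below their product.
  ((_ , _ , (_ , a′ , _ , c′ , _ , Ua′ , _ , Uc′ , _)) , b*log≤t) β^t*E≤1 (q , Uq , q<E) = absurd (1/^ᴿ-upper {x} {b} {q} 1<x real 1≤b Uq)
  where
  0<β = <-trans 0<1 1<β
  1<x = <-≤-trans 1<2 2≤x
  product-below : ∀ {ρ p s} → 0ℚ < ρ → 0ℚ < p → L b ρ → L (log β x) p → s < ρ * p → ι s <ᴿ b *ᴿ log β x
  product-below {ρ} {p} {s} 0<ρ 0<p Lρ Lp = *ᴿ-lower {b} {log β x} {s} {ρ} {a′} {p} {c′} 0<ρ 0<p
    Lρ Ua′ (<⇒≤ (IsReal.separated real Lρ Ua′))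
    Lp Uc′ (<⇒≤ (log-separated {β} {x} {p} {c′} 1<β 1<x (<⇒≤ 0<p) Lp Uc′))
  absurd : ∃[ r ] ∃[ ρ ] ∃[ j ] ∃[ k ]
    (0ℚ < r × 1ℚ < q * r × L b ρ × IsFraction ρ (ℤ.+ suc j) k × r ^ suc k < x ^ suc j) → ⊥
  absurd (r , ρ , j , k , 0<r , 1<qr , Lρ , ρ≃ , r^k<x^j) = b*log≤t (by-t t β^t<r)
    where
    0<ρ = fraction-pos {ρ} ρ≃
    0<q = 0<[q*r]⇒0<q {q} 0<r 1<qr
    β^t<r : β ^ t < r
    β^t<r = *-cancelʳ-<-nonNeg q {{nonNegative (<⇒≤ 0<q)}} (begin-strict
      β ^ t * q    <⟨ *-monoʳ-<-pos (β ^ t) {{positive (^-pos t 0<β)}} q<E ⟩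
      β ^ t * E    ≤⟨ β^t*E≤1 ⟩
      1ℚ           <⟨ 1<qr ⟩
      q * r        ≡⟨ *-comm q r ⟩
      r * q        ∎)
      where open ≤-Reasoning
    at-fraction : ∀ t .{{_ : ℕ.NonZero t}} → β ^ t < r → ∀ τ → IsFraction τ (ℤ.+ (t ℕ.* suc k)) j →
      ι (fromℕ t) <ᴿ b *ᴿ log β x
    -- `τ` is `t / ρ`, so `ρ * τ` is exactly `t`; a larger `ρ′` still below `b` pushes the product
    -- strictly above `t`.
    at-fraction t@(suc _) β^t<r τ τ≃ with Equivalence.to (IsReal.L-rounded real ρ) Lρ
    ... | ρ′ , ρ<ρ′ , Lρ′ = product-below {ρ′} {τ} {fromℕ t} (<-trans 0<ρ ρ<ρ′) 0<τ Lρ′ Lτ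
        (subst (_< ρ′ * τ) (fraction-scale {ρ} {τ} t ρ≃ τ≃) (*-monoˡ-<-pos τ {{positive 0<τ}} ρ<ρ′))
      where
      0<τ : 0ℚ < τ
      0<τ = fraction-pos {τ} τ≃
      Lτ : Pow< β τ x
      Lτ = Pow<-fraction τ τ≃ (<-trans 0<1 1<x) (begin-strict
        β ^ (t ℕ.* suc k)   ≡⟨ ^-assocʳ β t (suc k) ⟨
        (β ^ t) ^ suc k     <⟨ ^-mono-< k (^-nonNeg t (<⇒≤ 0<β)) β^t<r ⟩
        r ^ suc k           <⟨ r^k<x^j ⟩
        x ^ suc j           ∎) 0<β
        where open ≤-Reasoning
    at-zero : ∃[ p ] (0ℚ < p × L (log β x) p) → ι (fromℕ 0) <ᴿ b *ᴿ log β x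
    at-zero (p , 0<p , Lp) = product-below {ρ} {p} {fromℕ 0} 0<ρ 0<p Lρ Lp (*-pos 0<ρ 0<p)
    by-t : ∀ t → β ^ t < r → ι (fromℕ t) <ᴿ b *ᴿ log β x
    by-t zero _ = at-zero (log-lower-positive 2≤x 0<β)
    by-t (suc t-1) β^t<r = at-fraction (suc t-1) β^t<r τ (/-isFraction (ℤ.+ (suc t-1 ℕ.* suc k)) j)
      where τ = ℤ.+ (suc t-1 ℕ.* suc k) / suc j

-- From `ρ < b` and `b * c ≤ t` comes `c < t / ρ`, so `x ^ (- 1 / c)` is below `x ^ (- ρ / t)`. The
-- assumed failure of the bound places the latter below `δ`, and the factor `1 - u` leaves room for
-- a rational in between, contradicting the hypothesis on `γ`.
decay-by-root : ∀ {x b c γ u} t → 1ℚ < x → IsReal b → ι 1ℚ ≤ᴿ b → IsReal c → ι 1ℚ ≤ᴿ c →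
  0ℚ < u → u < 1ℚ → 0ℚ ≤ 1ℚ - γ →
  ι 1ℚ -ᴿ x ^ᴿ (-ᴿ 1/ᴿ c) ≤ᴿ ι γ → b *ᴿ c ≤ᴿ ι (fromℕ t) →
  ι ((1ℚ - γ) ^ t * (1ℚ - u)) ≤ᴿ 1/ᴿ (x ^ᴿ b)
decay-by-root {x} {b} {c} {γ} {u} t 1<x realᵇ 1≤b realᶜ 1≤c 0<u u<1 0≤δ root≤γ bc≤t (q , Uq , q<E) =
  absurd (1/^ᴿ-upper {x} {b} {q} 1<x realᵇ 1≤b Uq)
  where
  δ = 1ℚ - γ

  product-below : ∀ {ρ p s} → 0ℚ < ρ → 0ℚ < p → L b ρ → L c p → s < ρ * p → ι s <ᴿ b *ᴿ c
  product-below {ρ} {p} {s} 0<ρ 0<p Lρ Lp = below (IsReal.U-inhabited realᵇ) (IsReal.U-inhabited realᶜ)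
    where
    below : ∃[ a′ ] U b a′ → ∃[ c′ ] U c c′ → s < ρ * p → ι s <ᴿ b *ᴿ c
    below (a′ , Ua′) (c′ , Uc′) = *ᴿ-lower {b} {c} {s} {ρ} {a′} {p} {c′} 0<ρ 0<p
      Lρ Ua′ (<⇒≤ (IsReal.separated realᵇ Lρ Ua′)) Lp Uc′ (<⇒≤ (IsReal.separated realᶜ Lp Uc′))

  0<½ : 0ℚ < ½
  0<½ = fraction-pos {½} {0} {1} ½-isFraction

  absurd : ∃[ r ] ∃[ ρ ] ∃[ j ] ∃[ k ]
    (0ℚ < r × 1ℚ < q * r × L b ρ × IsFraction ρ (ℤ.+ suc j) k × r ^ suc k < x ^ suc j) → ⊥
  absurd (r , ρ , j , k , 0<r , 1<qr , Lρ , ρ≃ , r^k<x^j) = by-t t refl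
    where
    0<ρ = fraction-pos {ρ} ρ≃
    0<q = 0<[q*r]⇒0<q {q} 0<r 1<qr

    by-t : ∀ t′ → t ≡ t′ → ⊥
    by-t zero eq = bc≤t (subst (λ t → ι (fromℕ t) <ᴿ b *ᴿ c) (sym eq)
      (product-below {ρ} {½} {fromℕ 0} 0<ρ 0<½ Lρ (½-lower realᶜ 1≤c) (*-pos 0<ρ 0<½)))
    by-t (suc t-1) eq = at-fractions
      (ℤ.+ (suc t-1 ℕ.* suc k) / suc j) (/-isFraction (ℤ.+ (suc t-1 ℕ.* suc k)) j)
      -- This is `σ = 1 / τ`. Its denominator computes to the successor of `k + t-1 * suc k`, hence
      -- the index given to `IsFraction`.
      (ℤ.+ suc j / (suc t-1 ℕ.* suc k)) (/-isFraction (ℤ.+ suc j) (k ℕ.+ t-1 ℕ.* suc k))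
      where
      at-fractions :
        ∀ τ → IsFraction τ (ℤ.+ (suc t-1 ℕ.* suc k)) j →
        ∀ σ → IsFraction σ (ℤ.+ suc j) (k ℕ.+ t-1 ℕ.* suc k) → ⊥
      at-fractions τ τ≃ σ σ≃ = rounding (Equivalence.to (IsReal.L-rounded realᵇ ρ) Lρ)
        where
        0<τ = fraction-pos {τ} τ≃
        0<σ = fraction-pos {σ} σ≃
        ρτ≡t : ρ * τ ≡ fromℕ t
        ρτ≡t = trans (fraction-scale {ρ} {τ} (suc t-1) ρ≃ τ≃) (cong fromℕ (sym eq))

        -- If c < τ then x ^ (- 1 / c) < y = δ (1 - ε) < δ, where ε = u / t makes
        -- (1 - ε) ^ t ≥ 1 - u by Bernoulli's inequality.
        root : U c τ → ⊥
        root Uτ = rounded (Equivalence.to (IsReal.U-rounded realᶜ τ) Uτ)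
          where
          T R ε y : ℚ
          T = fromℕ t
          R = recip t
          ε = u * R
          y = δ * (1ℚ - ε)
          TR≡1 : T * R ≡ 1ℚ
          TR≡1 = subst (λ t → fromℕ t * recip t ≡ 1ℚ) (sym eq) (fromℕ-recip t-1)
          0<R : 0ℚ < R
          0<R = subst (λ t → 0ℚ < recip t) (sym eq) (positive⁻¹ (recip (suc t-1)) {{normalize-pos 1 (suc t-1)}})
          1≤T : 1ℚ ≤ T
          1≤T = fromℕ-mono-≤ {1} (subst (1 ℕ.≤_) (sym eq) (ℕ.s≤s ℕ.z≤n))
          R≤1 : R ≤ 1ℚ
          R≤1 = subst₂ _≤_ (*-identityˡ R) TR≡1 (*-monoʳ-≤-nonNeg R {{nonNegative (<⇒≤ 0<R)}} 1≤T)
          0<ε : 0ℚ < ε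
          0<ε = *-pos 0<u 0<R
          ε<1 : ε < 1ℚ
          ε<1 = ≤-<-trans (subst (ε ≤_) (*-identityʳ u) (*-monoˡ-≤-nonNeg u {{nonNegative (<⇒≤ 0<u)}} R≤1)) u<1
          0<δ : 0ℚ < δ
          -- As `t` is positive, `δ = 0` would make the expected potential vanish, although it
          -- exceeds the positive `q`.
          0<δ = ≰⇒> (λ δ≤0 → <-irrefl refl (<-trans 0<q (subst (q <_) (vanish (≤-antisym δ≤0 0≤δ)) q<E)))
            where
            vanish : δ ≡ 0ℚ → δ ^ t * (1ℚ - u) ≡ 0ℚ
            vanish δ≡0 = begin
              δ ^ t * (1ℚ - u)             ≡⟨ cong₂ (λ d s → d ^ s * (1ℚ - u)) δ≡0 eq ⟩
              0ℚ * 0ℚ ^ t-1 * (1ℚ - u)     ≡⟨ cong (_* (1ℚ - u)) (*-zeroˡ (0ℚ ^ t-1)) ⟩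
              0ℚ * (1ℚ - u)                ≡⟨ *-zeroˡ (1ℚ - u) ⟩
              0ℚ                           ∎
              where open ≡-Reasoning
          0<y : 0ℚ < y
          0<y = *-pos 0<δ (p<q⇒0<q-p ε<1)
          y<δ : y < δ
          y<δ = 0<q-p⇒p<q (subst (0ℚ <_) (lem δ ε) (*-pos 0<δ 0<ε))
            where
            lem : ∀ d e → d * e ≡ d - d * (1ℚ - e)
            lem = solve-∀ ring
          q<y^t : q < y ^ t
          q<y^t = begin-strict
            q                               <⟨ q<E ⟩
            δ ^ t * (1ℚ - u)                ≡⟨ cong (λ z → δ ^ t * (1ℚ - z)) (trans (sym (*-identityˡ u)) (trans (cong (_* u) (sym TR≡1)) (lem T R u))) ⟩
            δ ^ t * (1ℚ - T * ε)            ≤⟨ *-monoˡ-≤-nonNeg (δ ^ t) {{nonNegative (^-nonNeg t 0≤δ)}} (bernoulli t (<⇒≤ 0<ε) (<⇒≤ ε<1)) ⟩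
            δ ^ t * (1ℚ - ε) ^ t            ≡⟨ ^-distrib-* δ (1ℚ - ε) t ⟨
            y ^ t                           ∎
            where
            open ≤-Reasoning
            lem : ∀ T R u → T * R * u ≡ T * (u * R)
            lem = solve-∀ ring
          1<y^x^ : 1ℚ < y ^ (suc t-1 ℕ.* suc k) * x ^ suc j
          1<y^x^ = begin-strict
            1ℚ                                          <⟨ 1<^ k (<-trans 1<qr (*-monoˡ-<-pos r {{positive 0<r}} q<y^t)) ⟩
            (y ^ t * r) ^ suc k                         ≡⟨ ^-distrib-* (y ^ t) r (suc k) ⟩
            (y ^ t) ^ suc k * r ^ suc k                 <⟨ *-monoʳ-<-pos ((y ^ t) ^ suc k) {{positive (^-pos (suc k) (^-pos t 0<y))}} r^k<x^j ⟩
            (y ^ t) ^ suc k * x ^ suc j                 ≡⟨ cong (_* x ^ suc j) (trans (^-assocʳ y t (suc k)) (cong (λ s → y ^ (s ℕ.* suc k)) eq)) ⟩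
            y ^ (suc t-1 ℕ.* suc k) * x ^ suc j         ∎
            where open ≤-Reasoning
          rounded : ∃[ τ₀ ] (τ₀ < τ × U c τ₀) → ⊥
          rounded (τ₀ , τ₀<τ , Uτ₀) = conclude (<-dense γ<1-y)
            where
            γ<1-y : γ < 1ℚ - y
            γ<1-y = 0<q-p⇒p<q (subst (0ℚ <_) (lem γ y) (p<q⇒0<q-p y<δ))
              where
              lem : ∀ g y → 1ℚ - g - y ≡ 1ℚ - y - g
              lem = solve-∀ ring
            -- That `- σ` is an upper bound of `-ᴿ 1/ᴿ c` unfolds to a lower bound at the double
            -- negation. It holds because `τ₀ < τ` gives `σ * τ₀ < 1`.
            Lσ : L (1/ᴿ c) (- (- σ))
            Lσ = subst (L (1/ᴿ c)) (sym (neg-involutive σ))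
              ( τ₀
              , <-trans 0<½ (IsReal.separated realᶜ (½-lower realᶜ 1≤c) Uτ₀)
              , Uτ₀
              , subst (σ * τ₀ <_) (fraction-inverse {τ} {σ} τ≃ σ≃) (*-monoʳ-<-pos σ {{positive 0<σ}} τ₀<τ) )
            Uy : U (x ^ᴿ (-ᴿ 1/ᴿ c)) y
            Uy = - σ , Lσ , Pow<-neg-fraction (- σ) (neg-isFraction {σ} σ≃) 0<y 1<y^x^ (<-trans 0<1 1<x)
            -- Two intermediate rationals: `s` separates `γ` from the difference, and `s′` makes
            -- `s′ + y` a lower bound of 1 whose difference with `y` still exceeds `s`.
            conclude : ∃[ s ] (γ < s × s < 1ℚ - y) → ⊥
            conclude (s , γ<s , s<1-y) = conclude′ (<-dense s<1-y)
              where
              conclude′ : ∃[ s′ ] (s < s′ × s′ < 1ℚ - y) → ⊥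
              conclude′ (s′ , s<s′ , s′<1-y) = root≤γ
                (s , γ<s , s′ + y , y
                , subst (s′ + y <_) (lem₁ y) (+-monoˡ-< y s′<1-y)
                , Uy
                , subst (s <_) (lem₂ s′ y) s<s′)
                where
                lem₁ : ∀ y → 1ℚ - y + y ≡ 1ℚ
                lem₁ = solve-∀ ring
                lem₂ : ∀ s y → s ≡ s + y - y
                lem₂ = solve-∀ ring

        rounding : ∃[ ρ′ ] (ρ < ρ′ × L b ρ′) → ⊥
        rounding (ρ′ , ρ<ρ′ , Lρ′) = between (<-dense ρ<ρ′)
          where
          between : ∃[ ρ″ ] (ρ < ρ″ × ρ″ < ρ′) → ⊥
          -- The gap for `located` is `τ″ = t / ρ″ < τ = t / ρ`. If `τ″` lay below `c`, then
          -- `ρ′ * τ″ > t` would contradict `b * c ≤ t`; what remains is `c < τ`.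
          between (ρ″ , ρ<ρ″ , ρ″<ρ′) = by-location (IsReal.located realᶜ τ″<τ)
            where
            0<ρ″ = <-trans 0<ρ ρ<ρ″
            instance
              _ = pos⇒nonZero ρ″ {{positive 0<ρ″}}
            τ″ = 1/ ρ″ * fromℕ t
            0<T : 0ℚ < fromℕ t
            0<T = subst (0ℚ <_) ρτ≡t (*-pos 0<ρ 0<τ)
            0<τ″ : 0ℚ < τ″
            0<τ″ = *-pos (positive⁻¹ (1/ ρ″) {{1/pos⇒pos ρ″ {{positive 0<ρ″}}}}) 0<T
            ρ″τ″≡t : ρ″ * τ″ ≡ fromℕ t
            ρ″τ″≡t = begin
              ρ″ * (1/ ρ″ * fromℕ t)   ≡⟨ *-assoc ρ″ (1/ ρ″) (fromℕ t) ⟨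
              ρ″ * 1/ ρ″ * fromℕ t     ≡⟨ cong (_* fromℕ t) (*-inverseʳ ρ″) ⟩
              1ℚ * fromℕ t             ≡⟨ *-identityˡ (fromℕ t) ⟩
              fromℕ t                  ∎
              where open ≡-Reasoning
            τ″<τ : τ″ < τ
            τ″<τ = *-cancelˡ-<-nonNeg ρ {{nonNegative (<⇒≤ 0<ρ)}} (subst (ρ * τ″ <_)
              (trans ρ″τ″≡t (sym ρτ≡t)) (*-monoˡ-<-pos τ″ {{positive 0<τ″}} ρ<ρ″))
            by-location : L c τ″ ⊎ U c τ → ⊥
            by-location (inj₁ Lτ″) = bc≤t (product-below {ρ′} {τ″} {fromℕ t} (<-trans 0<ρ ρ<ρ′) 0<τ″ Lρ′ Lτ″
              (subst (_< ρ′ * τ″) ρ″τ″≡t (*-monoˡ-<-pos τ″ {{positive 0<τ″}} ρ″<ρ′)))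
            by-location (inj₂ Uτ) = root Uτ

-- Assembling the three bounds

geometric-bound : ∀ {β δ v} t → 0ℚ ≤ β → 0ℚ ≤ δ → β * δ ≤ 1ℚ → v ≤ 1ℚ → β ^ t * (δ ^ t * v) ≤ 1ℚ
geometric-bound {β} {δ} {v} t 0≤β 0≤δ βδ≤1 v≤1 = begin
  β ^ t * (δ ^ t * v)     ≡⟨ *-assoc (β ^ t) (δ ^ t) v ⟨
  β ^ t * δ ^ t * v       ≡⟨ cong (_* v) (^-distrib-* β δ t) ⟨
  (β * δ) ^ t * v         ≤⟨ *-monoˡ-≤-nonNeg ((β * δ) ^ t) {{nonNegative (^-nonNeg t (*-nonNeg 0≤β 0≤δ))}} v≤1 ⟩
  (β * δ) ^ t * 1ℚ        ≡⟨ *-identityʳ ((β * δ) ^ t) ⟩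
  (β * δ) ^ t             ≤⟨ ^-mono-≤ t (*-nonNeg 0≤β 0≤δ) βδ≤1 ⟩
  1ℚ ^ t                  ≡⟨ 1^n≡1 t ⟩
  1ℚ                      ∎
  where open ≤-Reasoning

recip-pos : ∀ {m} → 1 ℕ.≤ m → 0ℚ < recip m
recip-pos {suc m} _ = positive⁻¹ (recip (suc m)) {{normalize-pos 1 (suc m)}}

recip<1 : ∀ {m} → 2 ℕ.≤ m → recip m < 1ℚ
recip<1 {m} 2≤m = begin-strict
  recip m              ≡⟨ *-identityˡ (recip m) ⟨
  1ℚ * recip m         <⟨ *-monoˡ-<-pos (recip m) {{positive (recip-pos 1≤m)}} (<-≤-trans 1<2 (fromℕ-mono-≤ 2≤m)) ⟩
  fromℕ m * recip m    ≡⟨ fromℕ-recip′ 1≤m ⟩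
  1ℚ                   ∎
  where
  open ≤-Reasoning
  1≤m = ℕ.≤-trans (ℕ.s≤s ℕ.z≤n) 2≤m

theorem3 : (K M s f : ℕ) → 1 ℕ.≤ K → 1 ℕ.≤ s → s ℕ.≤ M → f ℕ.+ 2 ℕ.≤ M ℕ.* K →
    (H : Subset M) → ∣ H ∣ ≡ s →
    let open Mixnet K M f H in
    (w : Weights m) → IsDistribution w → .{{_ : Positive (Φ w)}} →
    let γ = expectedRelativeDecrease w in
    (b : Cut) → IsReal b → ι 1ℚ ≤ᴿ b →
    (0ℚ < γ → (γ<1 : γ < 1ℚ) → (t : ℕ) →
    t ≡⌈ b *ᴿ log (1/[1- γ ] γ<1) (fromℕ n) ⌉ →
    ι (𝔼Φ t) ≤ᴿ 1/ᴿ (fromℕ n ^ᴿ b))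
    × (½ ≤ γ → (t : ℕ) →
    t ≡⌈ b *ᴿ log (fromℕ 2) (fromℕ n) ⌉ →
    ι (𝔼Φ t) ≤ᴿ 1/ᴿ (fromℕ n ^ᴿ b))
    × ((c : Cut) → IsReal c → ι 1ℚ ≤ᴿ c →
    ι 1ℚ -ᴿ fromℕ n ^ᴿ (-ᴿ 1/ᴿ c) ≤ᴿ ι γ → (t : ℕ) →
    t ≡⌈ b *ᴿ c ⌉ →
    ι (𝔼Φ t) ≤ᴿ 1/ᴿ (fromℕ n ^ᴿ b))
theorem3 K M s f _ _ _ f+2≤n H _ w (_ , Σw≡1) b real 1≤b = by-gap , by-half , by-root
  where
  open Mixnet K M f H
  γ δ u : ℚ
  γ = expectedRelativeDecrease w
  δ = 1ℚ - γ
  u = recip m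
  2≤m : 2 ℕ.≤ m
  2≤m = ℕ.m+n≤o⇒m≤o∸n 2 (subst (ℕ._≤ n) (ℕ.+-comm f 2) f+2≤n)
  2≤n : fromℕ 2 ≤ fromℕ n
  2≤n = fromℕ-mono-≤ (ℕ.≤-trans 2≤m (ℕ.m∸n≤m n f))
  geometric : 0ℚ ≤ δ × (∀ t → 𝔼Φ t ≡ δ ^ t * (1ℚ - u))
  geometric = Rounds.𝔼Φ-geometric K M f H 2≤m w Σw≡1
  0≤δ = proj₁ geometric
  0<u : 0ℚ < u
  0<u = recip-pos (ℕ.≤-trans (ℕ.s≤s ℕ.z≤n) 2≤m)
  1-u≤1 : 1ℚ - u ≤ 1ℚ
  1-u≤1 = 0≤q-p⇒p≤q (subst (0ℚ ≤_) (lem u) (<⇒≤ 0<u))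
    where
    lem : ∀ u → u ≡ 1ℚ - (1ℚ - u)
    lem = solve-∀ ring
  from-geometric : ∀ {t} → ι (δ ^ t * (1ℚ - u)) ≤ᴿ 1/ᴿ (fromℕ n ^ᴿ b) → ι (𝔼Φ t) ≤ᴿ 1/ᴿ (fromℕ n ^ᴿ b)
  from-geometric {t} = subst (λ E → ι E ≤ᴿ 1/ᴿ (fromℕ n ^ᴿ b)) (sym (proj₂ geometric t))
  -- Serves both logarithmic bounds: `β = 1 / δ` gives `β * δ = 1`, and `γ ≥ ½` gives `2 * δ ≤ 1`.
  by-base : ∀ β t → 1ℚ < β → β * δ ≤ 1ℚ → t ≡⌈ b *ᴿ log β (fromℕ n) ⌉ → ι (𝔼Φ t) ≤ᴿ 1/ᴿ (fromℕ n ^ᴿ b)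
  by-base β t 1<β βδ≤1 t≡ = from-geometric {t} (decay-by-log t 2≤n 1<β real 1≤b t≡
    (geometric-bound t (<⇒≤ (<-trans 0<1 1<β)) 0≤δ βδ≤1 1-u≤1))
  by-gap : 0ℚ < γ → (γ<1 : γ < 1ℚ) → (t : ℕ) → t ≡⌈ b *ᴿ log (1/[1- γ ] γ<1) (fromℕ n) ⌉ →
    ι (𝔼Φ t) ≤ᴿ 1/ᴿ (fromℕ n ^ᴿ b)
  by-gap 0<γ γ<1 t = by-base β t 1<β (≤-reflexive βδ≡1)
    where
    β = 1/[1- γ ] γ<1
    βδ≡1 : β * δ ≡ 1ℚ
    βδ≡1 = *-inverseˡ δ {{>-nonZero (p<q⇒0<q-p γ<1)}}
    δ<1 : δ < 1ℚ
    δ<1 = 0<q-p⇒p<q (subst (0ℚ <_) (lem γ) 0<γ)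
      where
      lem : ∀ g → g ≡ 1ℚ - (1ℚ - g)
      lem = solve-∀ ring
    1<β : 1ℚ < β
    1<β = *-cancelʳ-<-nonNeg δ {{nonNegative 0≤δ}} (subst₂ _<_ (sym (*-identityˡ δ)) (sym βδ≡1) δ<1)
  by-half : ½ ≤ γ → (t : ℕ) → t ≡⌈ b *ᴿ log (fromℕ 2) (fromℕ n) ⌉ → ι (𝔼Φ t) ≤ᴿ 1/ᴿ (fromℕ n ^ᴿ b)
  by-half ½≤γ t = by-base (fromℕ 2) t 1<2 (subst (_≤ 1ℚ) (p+p≡2*p δ) (0≤q-p⇒p≤q (subst (0ℚ ≤_) (lem γ) (p≤q⇒0≤q-p 1≤γ+γ))))
    where
    1≤γ+γ : 1ℚ ≤ γ + γ
    1≤γ+γ = begin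
      1ℚ           ≡⟨ fraction-* {½} {1} {1} ½-isFraction ⟨
      ½ * fromℕ 2  ≤⟨ *-monoʳ-≤-nonNeg (fromℕ 2) {{fromℕ-nonNeg 2}} ½≤γ ⟩
      γ * fromℕ 2  ≡⟨ *-comm γ (fromℕ 2) ⟩
      fromℕ 2 * γ  ≡⟨ p+p≡2*p γ ⟨
      γ + γ        ∎
      where open ≤-Reasoning
    lem : ∀ g → (g + g) - 1ℚ ≡ 1ℚ - ((1ℚ - g) + (1ℚ - g))
    lem = solve-∀ ring
  by-root : (c : Cut) → IsReal c → ι 1ℚ ≤ᴿ c → ι 1ℚ -ᴿ fromℕ n ^ᴿ (-ᴿ 1/ᴿ c) ≤ᴿ ι γ → (t : ℕ) →
    t ≡⌈ b *ᴿ c ⌉ → ι (𝔼Φ t) ≤ᴿ 1/ᴿ (fromℕ n ^ᴿ b)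
  by-root c realᶜ 1≤c root≤γ t (_ , bc≤t) = from-geometric {t} (decay-by-root t (<-≤-trans 1<2 2≤n)
    real 1≤b realᶜ 1≤c 0<u (recip<1 2≤m) 0≤δ root≤γ bc≤t)
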